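{- Let $G$ be a graph such that both $G$ and its complement $\overline{G}$ are connected and neither is a tree. Let $m$ and $\overline{m}$ be the numbers of edges and $\lambda$ and $\overline{\lambda}$ the edge-connectivities of $G$ and $\overline{G}$, respectively, and let $w$ and $\overline{w}$ be normalised weight functions on $E(G)$ and $E(\overline{G})$, respectively. Then $$0\leq \mathrm{avec}(G,w)+\mathrm{avec}(\overline{G},\overline{w})\leq \frac{m}{\lambda}+\frac{\overline{m}}{\overline{\lambda}}$$ and $$0\leq \mathrm{avec}(G,w)\,\mathrm{avec}(\overline{G},\overline{w})\leq \frac{m\,\overline{m}}{\lambda\,\overline{\lambda}}.$$
   Context: Graphs are finite and simple. For a connected graph $H$ with $n$ vertices and $m$ edges, a weight function is a map $w:E(H)\to\mathbb{R}^{\geq 0}$; it is called normalised if $\sum_{e\in E(H)}w(e)=m$. The weighted distance $d_w(u,v)$ is the minimum, over all paths between $u$ and $v$ in $H$, of the sum of the weights of the edges of the path. The weighted eccentricity of a vertex $v$ is $e_w(v)=\max_{u\in V(H)}d_w(u,v)$, and the average eccentricity is $\mathrm{avec}(H,w)=\frac1n\sum_{v\in V(H)}e_w(v)$. The edge-connectivity of $H$ is the smallest number of edges whose deletion disconnects $H$. The complement $\overline{G}$ of $G$ has the same vertex set as $G$, two distinct vertices being adjacent in $\overline{G}$ if and only if they are not adjacent in $G$. -}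

module Defs where

open import Data.Bool.Base using (Bool; true; false; T; _∧_; not)
open import Data.Bool.Properties using (T?)
open import Data.Empty using (⊥)
open import Data.Fin.Base as Fin using (Fin)
open import Data.Fin.Properties as Fin using (injective⇒≤)
open import Data.Integer.Base using (+_)
open import Data.List.Base
  using (List; []; _∷_; map; foldr; head; last; length; lookup; mapMaybe;
         allFin; cartesianProduct; cartesianProductWith)
open import Data.List.Membership.Propositional using (_∈_)
open import Data.List.Membership.Propositional.Properties
  using (∈-allFin; ∈-cartesianProduct⁺; ∈-cartesianProductWith⁺; ∈-lookup)
import Data.List.Relation.Unary.All as All
open import Data.List.Relation.Unary.AllPairs using (_∷_)
open import Data.List.Relation.Unary.Any as Any using (Any; here; there)
import Data.List.Relation.Unary.Any.Properties as Any
open import Data.List.Relation.Unary.Linked as Linked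
  using (Linked; []; [-]; _∷_; linked?)
open import Data.List.Relation.Unary.Unique.Propositional using (Unique)
import Data.List.Relation.Unary.Unique.DecPropositional as DecUnique
open import Data.Maybe.Base using (Maybe; just; nothing)
open import Data.Maybe.Properties using (≡-dec)
import Data.Maybe.Relation.Unary.Any as Maybe
open import Data.Nat.Base as ℕ using (ℕ; zero; suc)
import Data.Nat.Properties as ℕ
open import Data.Product.Base using (∃-syntax; _×_; _,_)
open import Data.Rational.Base as ℚ using (ℚ; 0ℚ; 1ℚ; ½; ∣_∣; 1/_)
import Data.Rational.Properties as ℚ
open import Data.Rational.Solver using (module +-*-Solver)
open import Data.Sum.Base using (inj₁; inj₂)
open import Relation.Binary.Definitions using (tri<; tri≈; tri>)
open import Relation.Binary.PropositionalEquality
  using (_≡_; refl; sym; trans; cong; cong₂; subst)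
open import Relation.Nullary using (¬_; yes; no; contradiction)
open import Relation.Nullary.Negation.Core using (contradiction-irr)
open import Relation.Nullary.Decidable.Core using (⌊_⌋; ¬?)

-- Real numbers: Cauchy sequences of rationals, considered up to _≃_.
-- Arithmetic, minimum and maximum are computed termwise.

IsCauchy : (ℕ → ℚ) → Set
IsCauchy x = ∀ ε → 0ℚ ℚ.< ε →
  ∃[ N ] (∀ m n → N ℕ.≤ m → N ℕ.≤ n → ∣ x m ℚ.- x n ∣ ℚ.≤ ε)

record ℝ : Set where
  constructor mkℝ
  field
    seq    : ℕ → ℚ
    cauchy : IsCauchy seq

open ℝ public

infix 4 _≤_ _≃_

_≤_ : ℝ → ℝ → Set
x ≤ y = ∀ ε → 0ℚ ℚ.< ε →
  ∃[ N ] (∀ n → N ℕ.≤ n → seq x n ℚ.≤ seq y n ℚ.+ ε)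

_≃_ : ℝ → ℝ → Set
x ≃ y = x ≤ y × y ≤ x

private
  p≤∣p∣ : ∀ p → p ℚ.≤ ∣ p ∣
  p≤∣p∣ p with ℚ.≤-total 0ℚ p
  ... | inj₁ 0≤p = ℚ.≤-reflexive (sym (ℚ.0≤p⇒∣p∣≡p 0≤p))
  ... | inj₂ p≤0 =
    ℚ.≤-trans p≤0 (ℚ.nonNegative⁻¹ ∣ p ∣ {{ℚ.∣-∣-nonNeg p}})

  close⇒≤ : ∀ {p q ε} → ∣ p ℚ.- q ∣ ℚ.≤ ε → p ℚ.≤ q ℚ.+ ε
  close⇒≤ {p} {q} {ε} h = begin
    p                  ≡⟨ solve 2 (λ a b → a := b :+ (a :- b)) refl p q ⟩
    q ℚ.+ (p ℚ.- q)    ≤⟨ ℚ.+-monoʳ-≤ q (ℚ.≤-trans (p≤∣p∣ _) h) ⟩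
    q ℚ.+ ε            ∎
    where open ℚ.≤-Reasoning
          open +-*-Solver

  ≤⇒diff : ∀ {p q ε} → p ℚ.≤ q ℚ.+ ε → p ℚ.- q ℚ.≤ ε
  ≤⇒diff {p} {q} {ε} h = begin
    p ℚ.- q            ≤⟨ ℚ.+-monoˡ-≤ (ℚ.- q) h ⟩
    q ℚ.+ ε ℚ.- q      ≡⟨ solve 2 (λ b e → b :+ e :- b := e) refl q ε ⟩
    ε                  ∎
    where open ℚ.≤-Reasoning
          open +-*-Solver

  ≤⇒close : ∀ {p q ε} → p ℚ.≤ q ℚ.+ ε → q ℚ.≤ p ℚ.+ ε → ∣ p ℚ.- q ∣ ℚ.≤ ε
  ≤⇒close {p} {q} h k with ℚ.∣p∣≡p∨∣p∣≡-p (p ℚ.- q)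
  ... | inj₁ e = subst (ℚ._≤ _) (sym e) (≤⇒diff h)
  ... | inj₂ e = subst (ℚ._≤ _)
    (sym (trans e (solve 2 (λ a b → :- (a :- b) := b :- a) refl p q))) (≤⇒diff k)
    where open +-*-Solver

  halves : ∀ ε → ½ ℚ.* ε ℚ.+ ½ ℚ.* ε ≡ ε
  halves ε = trans (sym (ℚ.*-distribʳ-+ ε ½ ½)) (ℚ.*-identityˡ ε)

  *-pos : ∀ {p q} → 0ℚ ℚ.< p → 0ℚ ℚ.< q → 0ℚ ℚ.< p ℚ.* q
  *-pos {p} {q} 0<p 0<q = subst (ℚ._< p ℚ.* q) (ℚ.*-zeroʳ p)
    (ℚ.*-monoʳ-<-pos p {{ℚ.positive 0<p}} 0<q)

  0<½ : 0ℚ ℚ.< ½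
  0<½ = ℚ.positive⁻¹ ½

  ½≤ : ∀ {ε} → 0ℚ ℚ.< ε → ½ ℚ.* ε ℚ.≤ ε
  ½≤ {ε} 0<ε = begin
    ½ ℚ.* ε                 ≡⟨ sym (ℚ.+-identityʳ _) ⟩
    ½ ℚ.* ε ℚ.+ 0ℚ          ≤⟨ ℚ.+-monoʳ-≤ (½ ℚ.* ε) (ℚ.<⇒≤ (*-pos 0<½ 0<ε)) ⟩
    ½ ℚ.* ε ℚ.+ ½ ℚ.* ε     ≡⟨ halves ε ⟩
    ε                       ∎
    where open ℚ.≤-Reasoning

  module Termwise
    (f    : ℚ → ℚ → ℚ)
    (mono : ∀ {a b c d} → a ℚ.≤ b → c ℚ.≤ d → f a c ℚ.≤ f b d)
    (bump : ∀ a b {ε} → 0ℚ ℚ.< ε →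
            f (a ℚ.+ ½ ℚ.* ε) (b ℚ.+ ½ ℚ.* ε) ℚ.≤ f a b ℚ.+ ε)
    where

    termwise-cauchy : ∀ x y → IsCauchy x → IsCauchy y →
                      IsCauchy (λ n → f (x n) (y n))
    termwise-cauchy x y cx cy ε 0<ε
      with cx (½ ℚ.* ε) (*-pos 0<½ 0<ε) | cy (½ ℚ.* ε) (*-pos 0<½ 0<ε)
    ... | N , hx | M , hy = N ℕ.⊔ M , λ m n m≥ n≥ →
      ≤⇒close (step m n m≥ n≥) (step n m n≥ m≥)
      where
      step : ∀ m n → N ℕ.⊔ M ℕ.≤ m → N ℕ.⊔ M ℕ.≤ n →
             f (x m) (y m) ℚ.≤ f (x n) (y n) ℚ.+ ε
      step m n m≥ n≥ = ℚ.≤-trans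
        (mono (close⇒≤ (hx m n (ℕ.m⊔n≤o⇒m≤o N M m≥) (ℕ.m⊔n≤o⇒m≤o N M n≥)))
              (close⇒≤ (hy m n (ℕ.m⊔n≤o⇒n≤o N M m≥) (ℕ.m⊔n≤o⇒n≤o N M n≥))))
        (bump (x n) (y n) 0<ε)

fromℚ : ℚ → ℝ
fromℚ q = mkℝ (λ _ → q) λ ε 0<ε → 0 , λ _ _ _ _ →
  subst (ℚ._≤ ε) (sym (cong ∣_∣ (ℚ.+-inverseʳ q))) (ℚ.<⇒≤ 0<ε)

0ℝ : ℝ
0ℝ = fromℚ 0ℚ

fromℕ : ℕ → ℝ
fromℕ k = fromℚ (+ k ℚ./ 1)

infixl 6 _+_ _⊔_
infixl 7 _*_ _⊓_

_+_ : ℝ → ℝ → ℝ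
x + y = mkℝ (λ n → seq x n ℚ.+ seq y n)
  (termwise-cauchy (seq x) (seq y) (cauchy x) (cauchy y))
  where
  bump : ∀ a b {ε} → 0ℚ ℚ.< ε →
         (a ℚ.+ ½ ℚ.* ε) ℚ.+ (b ℚ.+ ½ ℚ.* ε) ℚ.≤ (a ℚ.+ b) ℚ.+ ε
  bump a b {ε} _ = ℚ.≤-reflexive (trans
    (solve 3 (λ a b h → (a :+ h) :+ (b :+ h) := (a :+ b) :+ (h :+ h)) refl
      a b (½ ℚ.* ε))
    (cong ((a ℚ.+ b) ℚ.+_) (halves ε)))
    where open +-*-Solver
  open Termwise ℚ._+_ ℚ.+-mono-≤ bump

_⊔_ : ℝ → ℝ → ℝ
x ⊔ y = mkℝ (λ n → seq x n ℚ.⊔ seq y n)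
  (termwise-cauchy (seq x) (seq y) (cauchy x) (cauchy y))
  where
  bump : ∀ a b {ε} → 0ℚ ℚ.< ε →
         (a ℚ.+ ½ ℚ.* ε) ℚ.⊔ (b ℚ.+ ½ ℚ.* ε) ℚ.≤ (a ℚ.⊔ b) ℚ.+ ε
  bump a b 0<ε = ℚ.⊔-lub (ℚ.+-mono-≤ (ℚ.p≤p⊔q a b) (½≤ 0<ε))
                         (ℚ.+-mono-≤ (ℚ.p≤q⊔p a b) (½≤ 0<ε))
  open Termwise ℚ._⊔_ ℚ.⊔-mono-≤ bump

_⊓_ : ℝ → ℝ → ℝ
x ⊓ y = mkℝ (λ n → seq x n ℚ.⊓ seq y n)
  (termwise-cauchy (seq x) (seq y) (cauchy x) (cauchy y))
  where
  bump : ∀ a b {ε} → 0ℚ ℚ.< ε →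
         (a ℚ.+ ½ ℚ.* ε) ℚ.⊓ (b ℚ.+ ½ ℚ.* ε) ℚ.≤ (a ℚ.⊓ b) ℚ.+ ε
  bump a b {ε} 0<ε with ℚ.⊓-sel a b
  ... | inj₁ e = ℚ.≤-trans (ℚ.p⊓q≤p (a ℚ.+ ½ ℚ.* ε) (b ℚ.+ ½ ℚ.* ε))
    (subst (λ c → a ℚ.+ ½ ℚ.* ε ℚ.≤ c ℚ.+ ε) (sym e) (ℚ.+-monoʳ-≤ a (½≤ 0<ε)))
  ... | inj₂ e = ℚ.≤-trans (ℚ.p⊓q≤q (a ℚ.+ ½ ℚ.* ε) (b ℚ.+ ½ ℚ.* ε))
    (subst (λ c → b ℚ.+ ½ ℚ.* ε ℚ.≤ c ℚ.+ ε) (sym e) (ℚ.+-monoʳ-≤ b (½≤ 0<ε)))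
  open Termwise ℚ._⊓_ ℚ.⊓-mono-≤ bump

private
  *-mono : ∀ {a b c d} → 0ℚ ℚ.≤ b → 0ℚ ℚ.≤ c →
           a ℚ.≤ b → c ℚ.≤ d → a ℚ.* c ℚ.≤ b ℚ.* d
  *-mono {b = b} {c = c} 0≤b 0≤c a≤b c≤d = ℚ.≤-trans
    (ℚ.*-monoʳ-≤-nonNeg c {{ℚ.nonNegative 0≤c}} a≤b)
    (ℚ.*-monoˡ-≤-nonNeg b {{ℚ.nonNegative 0≤b}} c≤d)

  0≤∣_∣ : ∀ p → 0ℚ ℚ.≤ ∣ p ∣
  0≤∣ p ∣ = ℚ.nonNegative⁻¹ ∣ p ∣ {{ℚ.∣-∣-nonNeg p}}

  eventually-bounded : ∀ x → IsCauchy x →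
    ∃[ K ] (0ℚ ℚ.< K × ∃[ N ] (∀ n → N ℕ.≤ n → ∣ x n ∣ ℚ.≤ K))
  eventually-bounded x cx with cx 1ℚ (ℚ.positive⁻¹ 1ℚ)
  ... | N , h = ∣ x N ∣ ℚ.+ 1ℚ
    , ℚ.+-mono-≤-< 0≤∣ x N ∣ (ℚ.positive⁻¹ 1ℚ)
    , N , λ n n≥ → begin
      ∣ x n ∣                          ≡⟨ cong ∣_∣ (solve 2 (λ a b → a := b :+ (a :- b)) refl (x n) (x N)) ⟩
      ∣ x N ℚ.+ (x n ℚ.- x N) ∣        ≤⟨ ℚ.∣p+q∣≤∣p∣+∣q∣ (x N) (x n ℚ.- x N) ⟩
      ∣ x N ∣ ℚ.+ ∣ x n ℚ.- x N ∣      ≤⟨ ℚ.+-monoʳ-≤ ∣ x N ∣ (h n N n≥ ℕ.≤-refl) ⟩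
      ∣ x N ∣ ℚ.+ 1ℚ                   ∎
    where open ℚ.≤-Reasoning
          open +-*-Solver

  scaled : ∀ K ε → 0ℚ ℚ.< K → 0ℚ ℚ.< ε →
           ∃[ δ ] (0ℚ ℚ.< δ × K ℚ.* δ ≡ ½ ℚ.* ε)
  scaled K ε 0<K 0<ε = 1/ K ℚ.* (½ ℚ.* ε)
    , *-pos (ℚ.positive⁻¹ (1/ K) {{ℚ.1/pos⇒pos K}}) (*-pos 0<½ 0<ε)
    , trans (sym (ℚ.*-assoc K (1/ K) _))
        (trans (cong (ℚ._* (½ ℚ.* ε)) (ℚ.*-inverseʳ K)) (ℚ.*-identityˡ _))
    where instance
      K-pos : ℚ.Positive K
      K-pos = ℚ.positive 0<K
      K-nonZero : ℚ.NonZero K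
      K-nonZero = ℚ.pos⇒nonZero K

  product-diff : ∀ a b c d →
    a ℚ.* b ℚ.- c ℚ.* d ≡ a ℚ.* (b ℚ.- d) ℚ.+ d ℚ.* (a ℚ.- c)
  product-diff = solve 4 (λ a b c d →
    a :* b :- c :* d := a :* (b :- d) :+ d :* (a :- c)) refl
    where open +-*-Solver

  product-close : ∀ a b c d {K L δ η ε} → 0ℚ ℚ.< K → 0ℚ ℚ.< L →
    L ℚ.* δ ≡ ½ ℚ.* ε → K ℚ.* η ≡ ½ ℚ.* ε →
    ∣ a ∣ ℚ.≤ K → ∣ d ∣ ℚ.≤ L → ∣ a ℚ.- c ∣ ℚ.≤ δ → ∣ b ℚ.- d ∣ ℚ.≤ η →
    ∣ a ℚ.* b ℚ.- c ℚ.* d ∣ ℚ.≤ ε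
  product-close a b c d {K} {L} {δ} {η} {ε} 0<K 0<L Lδ Kη a≤K d≤L ac bd = begin
    ∣ a ℚ.* b ℚ.- c ℚ.* d ∣
      ≡⟨ cong ∣_∣ (product-diff a b c d) ⟩
    ∣ a ℚ.* (b ℚ.- d) ℚ.+ d ℚ.* (a ℚ.- c) ∣
      ≤⟨ ℚ.∣p+q∣≤∣p∣+∣q∣ (a ℚ.* (b ℚ.- d)) (d ℚ.* (a ℚ.- c)) ⟩
    ∣ a ℚ.* (b ℚ.- d) ∣ ℚ.+ ∣ d ℚ.* (a ℚ.- c) ∣
      ≡⟨ cong₂ ℚ._+_ (ℚ.∣p*q∣≡∣p∣*∣q∣ a (b ℚ.- d)) (ℚ.∣p*q∣≡∣p∣*∣q∣ d (a ℚ.- c)) ⟩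
    ∣ a ∣ ℚ.* ∣ b ℚ.- d ∣ ℚ.+ ∣ d ∣ ℚ.* ∣ a ℚ.- c ∣
      ≤⟨ ℚ.+-mono-≤ (*-mono (ℚ.<⇒≤ 0<K) 0≤∣ b ℚ.- d ∣ a≤K bd)
                    (*-mono (ℚ.<⇒≤ 0<L) 0≤∣ a ℚ.- c ∣ d≤L ac) ⟩
    K ℚ.* η ℚ.+ L ℚ.* δ
      ≡⟨ cong₂ ℚ._+_ Kη Lδ ⟩
    ½ ℚ.* ε ℚ.+ ½ ℚ.* ε
      ≡⟨ halves ε ⟩
    ε ∎
    where open ℚ.≤-Reasoning

  *-cauchy : ∀ x y → IsCauchy x → IsCauchy y →
             IsCauchy (λ n → x n ℚ.* y n)
  *-cauchy x y cx cy ε 0<ε =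
    let K , 0<K , A , bx = eventually-bounded x cx
        L , 0<L , B , by = eventually-bounded y cy
        δ , 0<δ , Lδ = scaled L ε 0<L 0<ε
        η , 0<η , Kη = scaled K ε 0<K 0<ε
        C , hx = cx δ 0<δ
        D , hy = cy η 0<η
    in (A ℕ.⊔ B) ℕ.⊔ (C ℕ.⊔ D) , λ m n m≥ n≥ →
      let AB≤m = ℕ.m⊔n≤o⇒m≤o (A ℕ.⊔ B) (C ℕ.⊔ D) m≥
          AB≤n = ℕ.m⊔n≤o⇒m≤o (A ℕ.⊔ B) (C ℕ.⊔ D) n≥
          CD≤m = ℕ.m⊔n≤o⇒n≤o (A ℕ.⊔ B) (C ℕ.⊔ D) m≥
          CD≤n = ℕ.m⊔n≤o⇒n≤o (A ℕ.⊔ B) (C ℕ.⊔ D) n≥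
      in product-close (x m) (y m) (x n) (y n) 0<K 0<L Lδ Kη
           (bx m (ℕ.m⊔n≤o⇒m≤o A B AB≤m)) (by n (ℕ.m⊔n≤o⇒n≤o A B AB≤n))
           (hx m n (ℕ.m⊔n≤o⇒m≤o C D CD≤m) (ℕ.m⊔n≤o⇒m≤o C D CD≤n))
           (hy m n (ℕ.m⊔n≤o⇒n≤o C D CD≤m) (ℕ.m⊔n≤o⇒n≤o C D CD≤n))

_*_ : ℝ → ℝ → ℝ
x * y = mkℝ (λ n → seq x n ℚ.* seq y n)
  (*-cauchy (seq x) (seq y) (cauchy x) (cauchy y))

∑ : List ℝ → ℝ
∑ = foldr _+_ 0ℝ

record Graph (n : ℕ) : Set where
  field
    adj        : Fin n → Fin n → Bool
    adj-sym    : ∀ u v → adj u v ≡ adj v u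
    adj-irrefl : ∀ v → adj v v ≡ false

open Graph public

Adj : ∀ {n} → Graph n → Fin n → Fin n → Set
Adj H u v = T (adj H u v)

∁ : ∀ {n} → Graph n → Graph n
∁ {n} G = record
  { adj        = λ u v → ⌊ ¬? (u Fin.≟ v) ⌋ ∧ not (adj G u v)
  ; adj-sym    = λ u v → cong₂ _∧_ (≢-sym u v) (cong not (adj-sym G u v))
  ; adj-irrefl = irrefl
  }
  where
  ≢-sym : ∀ (u v : Fin n) → ⌊ ¬? (u Fin.≟ v) ⌋ ≡ ⌊ ¬? (v Fin.≟ u) ⌋
  ≢-sym u v with u Fin.≟ v | v Fin.≟ u
  ... | yes _   | yes _   = refl
  ... | no _    | no _    = refl
  ... | yes u≡v | no v≢u  = contradiction (sym u≡v) v≢u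
  ... | no u≢v  | yes v≡u = contradiction (sym v≡u) u≢v
  irrefl : ∀ v → ⌊ ¬? (v Fin.≟ v) ⌋ ∧ not (adj G v v) ≡ false
  irrefl v with v Fin.≟ v
  ... | yes _  = refl
  ... | no v≢v = contradiction refl v≢v

-- An edge is an unordered pair, stored with its smaller end first.
record Edge {n} (H : Graph n) : Set where
  constructor mkEdge
  field
    end₁ end₂ : Fin n
    .ordered  : end₁ Fin.< end₂
    .adjacent : Adj H end₁ end₂

edge : ∀ {n} (H : Graph n) {u v : Fin n} → Adj H u v → Edge H
edge H {u} {v} uv with Fin.<-cmp u v
... | tri< u<v _ _ = mkEdge u v u<v uv
... | tri≈ _ refl _ = contradiction (subst T (adj-irrefl H u) uv) (λ ())
... | tri> _ _ v<u = mkEdge v u v<u (subst T (adj-sym H u v) uv)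

edge? : ∀ {n} (H : Graph n) → Fin n × Fin n → Maybe (Edge H)
edge? H (u , v) with u Fin.<? v | T? (adj H u v)
... | yes u<v | yes uv = just (mkEdge u v u<v uv)
... | _       | _      = nothing

edges : ∀ {n} (H : Graph n) → List (Edge H)
edges {n} H = mapMaybe (edge? H) (cartesianProduct (allFin n) (allFin n))

numEdges : ∀ {n} → Graph n → ℕ
numEdges H = length (edges H)

record Path {n} (H : Graph n) (u v : Fin n) : Set where
  constructor mkPath
  field
    vertices : List (Fin n)
    starts   : head vertices ≡ just u
    ends     : last vertices ≡ just v
    linked   : Linked (Adj H) vertices
    unique   : Unique vertices

-- A connected graph has at least one vertex.
record Connected {n} (H : Graph n) : Set where
  field
    nonEmpty : ℕ.NonZero n
    path     : ∀ u v → Path H u v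

record Cycle {n} (H : Graph n) : Set where
  field
    first final : Fin n
    vertices    : List (Fin n)
    starts      : head vertices ≡ just first
    ends        : last vertices ≡ just final
    linked      : Linked (Adj H) vertices
    unique      : Unique vertices
    closes      : Adj H final first
    long        : 3 ℕ.≤ length vertices

IsTree : ∀ {n} → Graph n → Set
IsTree H = Connected H × ¬ Cycle H

-- A set of edges of H is encoded as the graph F on
-- the same vertices having exactly these edges, so F ⊆ᴱ H.

_⊆ᴱ_ : ∀ {n} → Graph n → Graph n → Set
F ⊆ᴱ H = ∀ u v → Adj F u v → Adj H u v

_∖_ : ∀ {n} → Graph n → Graph n → Graph n
H ∖ F = record
  { adj        = λ u v → adj H u v ∧ not (adj F u v)
  ; adj-sym    = λ u v → cong₂ _∧_ (adj-sym H u v) (cong not (adj-sym F u v))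
  ; adj-irrefl = λ v → cong (_∧ not (adj F v v)) (adj-irrefl H v)
  }

Disconnects : ∀ {n} → Graph n → Graph n → Set
Disconnects F H = F ⊆ᴱ H × ¬ Connected (H ∖ F)

record IsEdgeConnectivity {n} (H : Graph n) (k : ℕ) : Set where
  field
    attained : ∃[ F ] (Disconnects F H × numEdges F ≡ k)
    minimal  : ∀ F → Disconnects F H → k ℕ.≤ numEdges F

private
  edge?-complete : ∀ {n} (H : Graph n) (e : Edge H) →
    Maybe.Any (e ≡_) (edge? H (Edge.end₁ e , Edge.end₂ e))
  edge?-complete H (mkEdge u v u<v uv)
    with u Fin.<? v | T? (adj H u v)
  ... | yes _   | yes _   = Maybe.just refl
  ... | no u≮v  | _       = contradiction-irr u<v u≮v
  ... | yes _   | no ¬uv = contradiction-irr uv ¬uv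

edges-complete : ∀ {n} (H : Graph n) (e : Edge H) → e ∈ edges H
edges-complete H e = Any.mapMaybe⁺ (edge? H) _
  (Any.map⁺ (Any.map (λ { refl → edge?-complete H e })
    (∈-cartesianProduct⁺ (∈-allFin (Edge.end₁ e)) (∈-allFin (Edge.end₂ e)))))

-- The edge-connectivity of a connected graph is positive, so that one may
-- divide by it.
edgeConnectivity-nonZero : ∀ {n} {H : Graph n} {k} →
  Connected H → IsEdgeConnectivity H k → ℕ.NonZero k
edgeConnectivity-nonZero {k = suc _} _ _ = _
edgeConnectivity-nonZero {H = H} {k = zero} c isEC
  with IsEdgeConnectivity.attained isEC
... | F , (_ , ¬connected) , |F|≡0 = contradiction still-connected ¬connected
  where
  none : ∀ {E : Set} {e : E} {es} → e ∈ es → length es ≡ 0 → ⊥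
  none (here _)  ()
  none (there _) ()

  keep : ∀ {u v} → Adj H u v → Adj (H ∖ F) u v
  keep {u} {v} uv with adj H u v | adj F u v in eq
  ... | true | false = _
  ... | true | true  =
    none (edges-complete F (edge F (subst T (sym eq) _))) |F|≡0

  still-connected : Connected (H ∖ F)
  still-connected = record
    { nonEmpty = Connected.nonEmpty c
    ; path     = λ u v → let open Path (Connected.path c u v) in
        mkPath vertices starts ends (Linked.map keep linked) unique
    }

-- A path visits each vertex at most once, so paths
-- can be enumerated by filtering the vertex lists of length at most n.

listsUpTo : ∀ n → ℕ → List (List (Fin n))
listsUpTo n zero    = [] ∷ []
listsUpTo n (suc k) = [] ∷ cartesianProductWith _∷_ (allFin n) (listsUpTo n k)

path? : ∀ {n} (H : Graph n) (u v : Fin n) → List (Fin n) → Maybe (Path H u v)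
path? H u v xs
  with ≡-dec Fin._≟_ (head xs) (just u) | ≡-dec Fin._≟_ (last xs) (just v)
     | linked? (λ a b → T? (adj H a b)) xs | DecUnique.unique? Fin._≟_ xs
... | yes s | yes e | yes l | yes q = just (mkPath xs s e l q)
... | _     | _     | _     | _     = nothing

paths : ∀ {n} (H : Graph n) (u v : Fin n) → List (Path H u v)
paths {n} H u v = mapMaybe (path? H u v) (listsUpTo n n)

private
  listsUpTo-complete : ∀ {n} k (xs : List (Fin n)) → length xs ℕ.≤ k →
                       xs ∈ listsUpTo n k
  listsUpTo-complete zero    []       _  = here refl
  listsUpTo-complete (suc k) []       _  = here refl
  listsUpTo-complete (suc k) (x ∷ xs) (ℕ.s≤s le) = there
    (∈-cartesianProductWith⁺ _∷_ (∈-allFin x) (listsUpTo-complete k xs le))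

  lookup-injective : ∀ {A : Set} {xs : List A} → Unique xs →
    ∀ {i j} → lookup xs i ≡ lookup xs j → i ≡ j
  lookup-injective (_ ∷ _) {Fin.zero}  {Fin.zero}  _ = refl
  lookup-injective {xs = _ ∷ xs} (p ∷ _) {Fin.zero} {Fin.suc j} e =
    contradiction e (All.lookup p (∈-lookup {xs = xs} j))
  lookup-injective {xs = _ ∷ xs} (p ∷ _) {Fin.suc i} {Fin.zero} e =
    contradiction (sym e) (All.lookup p (∈-lookup {xs = xs} i))
  lookup-injective (_ ∷ q) {Fin.suc i} {Fin.suc j} e =
    cong Fin.suc (lookup-injective q e)

  path?-complete : ∀ {n} (H : Graph n) {u v} (p : Path H u v) →
    Maybe.Any (λ q → Path.vertices q ≡ Path.vertices p)
              (path? H u v (Path.vertices p))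
  path?-complete H {u} {v} (mkPath xs s e l q)
    with ≡-dec Fin._≟_ (head xs) (just u) | ≡-dec Fin._≟_ (last xs) (just v)
       | linked? (λ a b → T? (adj H a b)) xs | DecUnique.unique? Fin._≟_ xs
  ... | yes _ | yes _ | yes _ | yes _ = Maybe.just refl
  ... | no ¬s | _     | _     | _     = contradiction s ¬s
  ... | yes _ | no ¬e | _     | _     = contradiction e ¬e
  ... | yes _ | yes _ | no ¬l | _     = contradiction l ¬l
  ... | yes _ | yes _ | yes _ | no ¬q = contradiction q ¬q

paths-complete : ∀ {n} (H : Graph n) {u v} (p : Path H u v) →
  Any (λ q → Path.vertices q ≡ Path.vertices p) (paths H u v)
paths-complete {n} H p = Any.mapMaybe⁺ (path? H _ _) (listsUpTo n n)
  (Any.map⁺ (Any.map (λ { refl → path?-complete H p })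
    (listsUpTo-complete n (Path.vertices p)
      (injective⇒≤ (lookup-injective (Path.unique p))))))

record WeightFunction {n} (H : Graph n) : Set where
  field
    weight   : Edge H → ℝ
    weight≥0 : ∀ e → 0ℝ ≤ weight e

open WeightFunction public

IsNormalised : ∀ {n} {H : Graph n} → WeightFunction H → Set
IsNormalised {H = H} w = ∑ (map (weight w) (edges H)) ≃ fromℕ (numEdges H)

module _ {n} {H : Graph n} (w : WeightFunction H) where

  linkedWeight : ∀ {xs} → Linked (Adj H) xs → ℝ
  linkedWeight []       = 0ℝ
  linkedWeight [-]      = 0ℝ
  linkedWeight (uv ∷ l) = weight w (edge H uv) + linkedWeight l

  pathWeight : ∀ {u v} → Path H u v → ℝ
  pathWeight p = linkedWeight (Path.linked p)

  -- The minimum of a non-empty family is a fold starting from one of its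
  -- members; here that member is the path provided by connectedness.
  distance : Connected H → Fin n → Fin n → ℝ
  distance c u v =
    foldr _⊓_ (pathWeight (Connected.path c u v)) (map pathWeight (paths H u v))

  eccentricity : Connected H → Fin n → ℝ
  eccentricity c v =
    foldr _⊔_ (distance c v v) (map (λ u → distance c u v) (allFin n))

  avec : Connected H → ℝ
  avec c = fromℚ ((+ 1 ℚ./ n) {{Connected.nonEmpty c}})
         * ∑ (map (eccentricity c) (allFin n))

{-# OPTIONS --safe #-}
module Submission where

-- Both bounds come from one inequality for a single connected graph H with
-- m edges and edge-connectivity k: every eccentricity under a normalised
-- weight function is at most m / k. Averaging gives 0 ≤ avec ≤ m / k, and
-- the sum and the product of two such estimates are the theorem.
--
-- Fix a vertex v and let f x be the weighted distance from x to v. Then f is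
-- at most 0 at v, and it is 1-Lipschitz: the values at the ends of an edge
-- differ by at most the weight of that edge (distance-lipschitz). For each t
-- with f v ≤ t < f u, the edges that leave the level set { x | f x > t }
-- disconnect H (cut-disconnects), so there are at least k of them. Integrating
-- this over t bounds k · (f u - f v) by the sum of | f x - f y | over the edges
-- xy, hence by the total weight. The integral is a finite sum over the sorted
-- values of f, done by induction on them (coarea, capacity-bound).
--
-- Constructively, a minimum of real numbers need not be attained. The argument is
-- therefore carried out separately for each index i of the Cauchy sequences,
-- where all quantities are rational and comparisons are decidable. The i-th
-- terms of nonnegative weights may be negative; replacing each weight by its
-- maximum with 0 repairs this, does not decrease any eccentricity and does not
-- change the total weight as a real number (eccentricity-bound).

open import Defs
open import Data.Integer.Base using () renaming (+_ to pos)
open import Data.Nat.Base using (ℕ) renaming (_*_ to _*ℕ_)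
open import Data.Nat.Properties using (m*n≢0)
open import Data.Product.Base using (_×_)
open import Data.Rational.Base using (_/_)
open import Relation.Nullary using (¬_)

open import Data.Bool.Base using (Bool; true; false; T; _∧_; _xor_)
open import Data.Bool.Properties using (T?; T-∧; T-irrelevant; xor-comm)
open import Data.Fin.Base as Fin using (Fin)
import Data.Fin.Properties as Fin
import Data.Integer.Base as ℤ
import Data.Integer.Properties as ℤ
open import Data.List.Base
  using (List; []; _∷_; foldr; map; head; last; length; filterᵇ; mapMaybe;
         allFin; cartesianProduct)
open import Data.List.Membership.Propositional using (_∈_)
open import Data.List.Membership.Propositional.Properties using (∈-allFin; ∈-map⁺)
import Data.List.Membership.DecPropositional as DecMembership
open import Data.List.Properties using (length-tabulate; filter-accept; filter-reject)
import Data.List.Relation.Unary.All as All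
open import Data.List.Relation.Unary.All.Properties using (¬Any⇒All¬)
open import Data.List.Relation.Unary.AllPairs as AllPairs using (AllPairs)
open import Data.List.Relation.Unary.Any using (Any; here; there)
open import Data.List.Relation.Unary.Linked as Linked using (Linked; []; [-]; _∷_)
open import Data.List.Relation.Unary.Linked.Properties using (Linked⇒AllPairs)
open import Data.List.Relation.Unary.Unique.Propositional using (Unique)
open import Data.List.Relation.Binary.Permutation.Propositional using (↭-sym)
open import Data.List.Relation.Binary.Permutation.Propositional.Properties using (∈-resp-↭)
open import Data.Maybe.Base using (just)
import Data.Nat.Base as ℕ
import Data.Nat.Properties as ℕ
open import Data.Product.Base using (∃-syntax; _,_; proj₁; proj₂)
open import Data.Rational.Base as ℚ using (ℚ; 0ℚ; 1ℚ; ½; ∣_∣; 1/_)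
import Data.Rational.Properties as ℚ
open import Data.Rational.Solver using (module +-*-Solver)
import Data.Rational.Unnormalised.Base as ℚᵘ
import Data.Rational.Unnormalised.Properties as ℚᵘ
open import Data.List.Sort ℚ.≤-decTotalOrder using (sort; sort-↭; sort-↗)
open import Data.Sum.Base using (inj₁; inj₂)
open import Data.Unit.Base using (tt)
open import Function.Base using (case_of_)
open import Function.Bundles using (Equivalence)
open import Relation.Binary.Definitions using (tri<; tri≈; tri>)
open import Relation.Binary.PropositionalEquality
  using (_≡_; refl; sym; trans; cong; cong₂; subst; subst₂)
open import Relation.Nullary using (yes; no; contradiction)
open import Relation.Nullary.Decidable.Core using (⌊_⌋; recompute)
open import Relation.Nullary.Negation.Core using (contradiction-irr)

-- Rational arithmetic

0≤p*q : ∀ {p q} → 0ℚ ℚ.≤ p → 0ℚ ℚ.≤ q → 0ℚ ℚ.≤ p ℚ.* q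
0≤p*q {p} {q} 0≤p 0≤q = subst (ℚ._≤ p ℚ.* q) (ℚ.*-zeroʳ p)
  (ℚ.*-monoˡ-≤-nonNeg p {{ℚ.nonNegative 0≤p}} 0≤q)

0<p*q : ∀ {p q} → 0ℚ ℚ.< p → 0ℚ ℚ.< q → 0ℚ ℚ.< p ℚ.* q
0<p*q {p} {q} 0<p 0<q = subst (ℚ._< p ℚ.* q) (ℚ.*-zeroʳ p)
  (ℚ.*-monoʳ-<-pos p {{ℚ.positive 0<p}} 0<q)

0≤q-p : ∀ {p q} → p ℚ.≤ q → 0ℚ ℚ.≤ q ℚ.- p
0≤q-p {p} {q} p≤q = subst (ℚ._≤ q ℚ.- p) (ℚ.+-inverseʳ p) (ℚ.+-monoˡ-≤ (ℚ.- p) p≤q)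

½ε+½ε≡ε : ∀ ε → ½ ℚ.* ε ℚ.+ ½ ℚ.* ε ≡ ε
½ε+½ε≡ε ε = trans (sym (ℚ.*-distribʳ-+ ε ½ ½)) (ℚ.*-identityˡ ε)

fraction-* : ∀ a b c d .{{b≢0 : ℕ.NonZero b}} .{{d≢0 : ℕ.NonZero d}} →
  (pos a / b) ℚ.* (pos c / d) ≡ (pos (a *ℕ c) / (b *ℕ d)) {{m*n≢0 b d}}
fraction-* a b@(ℕ.suc b-1) c d@(ℕ.suc d-1) = ℚ.toℚᵘ-injective (begin
  ℚ.toℚᵘ ((pos a / b) ℚ.* (pos c / d))
    ≈⟨ ℚ.toℚᵘ-homo-* (pos a / b) (pos c / d) ⟩
  ℚ.toℚᵘ (pos a / b) ℚᵘ.* ℚ.toℚᵘ (pos c / d)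
    ≈⟨ ℚᵘ.*-cong (ℚ.toℚᵘ-fromℚᵘ (ℚᵘ.mkℚᵘ (pos a) b-1))
                 (ℚ.toℚᵘ-fromℚᵘ (ℚᵘ.mkℚᵘ (pos c) d-1)) ⟩
  ℚᵘ.mkℚᵘ (pos a ℤ.* pos c) _
    ≡⟨ cong (λ z → ℚᵘ.mkℚᵘ z _) (sym (ℤ.pos-* a c)) ⟩
  ℚᵘ.mkℚᵘ (pos (a *ℕ c)) _
    ≈⟨ ℚ.toℚᵘ-fromℚᵘ (ℚᵘ.mkℚᵘ (pos (a *ℕ c)) _) ⟨
  ℚ.toℚᵘ ((pos (a *ℕ c) / (b *ℕ d)) {{m*n≢0 b d}}) ∎)
  where open import Relation.Binary.Reasoning.Setoid ℚᵘ.≃-setoid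

-- The embedding of the naturals that underlies fromℕ.
toℚ : ℕ → ℚ
toℚ n = pos n / 1

toℚ-suc : ∀ n → toℚ (ℕ.suc n) ≡ 1ℚ ℚ.+ toℚ n
toℚ-suc n = ℚ.toℚᵘ-injective (begin
  ℚ.toℚᵘ (toℚ (ℕ.suc n))
    ≈⟨ ℚ.toℚᵘ-fromℚᵘ (ℚᵘ.mkℚᵘ (pos (ℕ.suc n)) 0) ⟩
  ℚᵘ.mkℚᵘ (pos (ℕ.suc n)) 0
    ≡⟨ cong (λ z → ℚᵘ.mkℚᵘ (pos 1 ℤ.+ z) 0) (sym (ℤ.*-identityʳ (pos n))) ⟩
  ℚᵘ.1ℚᵘ ℚᵘ.+ ℚᵘ.mkℚᵘ (pos n) 0
    ≈⟨ ℚᵘ.+-congʳ ℚᵘ.1ℚᵘ (ℚ.toℚᵘ-fromℚᵘ (ℚᵘ.mkℚᵘ (pos n) 0)) ⟨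
  ℚ.toℚᵘ 1ℚ ℚᵘ.+ ℚ.toℚᵘ (toℚ n)
    ≈⟨ ℚ.toℚᵘ-homo-+ 1ℚ (toℚ n) ⟨
  ℚ.toℚᵘ (1ℚ ℚ.+ toℚ n) ∎)
  where open import Relation.Binary.Reasoning.Setoid ℚᵘ.≃-setoid

0≤fraction : ∀ a b .{{b≢0 : ℕ.NonZero b}} → 0ℚ ℚ.≤ pos a / b
0≤fraction a b = ℚ.nonNegative⁻¹ (pos a / b) {{ℚ.normalize-nonNeg a b}}

toℚ-mono-≤ : ∀ {m n} → m ℕ.≤ n → toℚ m ℚ.≤ toℚ n
toℚ-mono-≤ {n = n} ℕ.z≤n = 0≤fraction n 1
toℚ-mono-≤ {ℕ.suc m} {ℕ.suc n} (ℕ.s≤s m≤n)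
  rewrite toℚ-suc m | toℚ-suc n = ℚ.+-monoʳ-≤ 1ℚ (toℚ-mono-≤ m≤n)

1/n*n≡1 : ∀ n .{{n≢0 : ℕ.NonZero n}} → (pos 1 / n) ℚ.* toℚ n ≡ 1ℚ
1/n*n≡1 n = trans (fraction-* 1 n n 1) (ℚ.toℚᵘ-injective (cancel n))
  where
  cancel : ∀ n .{{n≢0 : ℕ.NonZero n}} →
    ℚ.toℚᵘ ((pos (1 *ℕ n) / (n *ℕ 1)) {{m*n≢0 n 1}}) ℚᵘ.≃ ℚ.toℚᵘ 1ℚ
  cancel (ℕ.suc n-1) = ℚᵘ.≃-trans
    (ℚ.toℚᵘ-fromℚᵘ (ℚᵘ.mkℚᵘ (pos (1 *ℕ ℕ.suc n-1)) (n-1 *ℕ 1)))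
    (ℚᵘ.*≡* (cong pos (trans (ℕ.*-identityʳ (1 *ℕ ℕ.suc n-1))
      (trans (ℕ.*-comm 1 (ℕ.suc n-1)) (sym (ℕ.*-identityˡ (ℕ.suc n-1 *ℕ 1)))))))

1/k*m≡m/k : ∀ m k .{{k≢0 : ℕ.NonZero k}} → (pos 1 / k) ℚ.* toℚ m ≡ pos m / k
1/k*m≡m/k m k = trans (fraction-* 1 k m 1)
  (ℚ./-cong {{m*n≢0 k 1}} (cong pos (ℕ.*-identityˡ m)) (ℕ.*-identityʳ k))

-- Finite sums of rationals

sum : {A : Set} → (A → ℚ) → List A → ℚ
sum g = foldr (λ x s → g x ℚ.+ s) 0ℚ

sum-mono : {A : Set} {g h : A → ℚ} → (∀ x → g x ℚ.≤ h x) →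
  ∀ xs → sum g xs ℚ.≤ sum h xs
sum-mono g≤h []       = ℚ.≤-refl
sum-mono g≤h (x ∷ xs) = ℚ.+-mono-≤ (g≤h x) (sum-mono g≤h xs)

sum-nonneg : {A : Set} {g : A → ℚ} → (∀ x → 0ℚ ℚ.≤ g x) →
  ∀ xs → 0ℚ ℚ.≤ sum g xs
sum-nonneg 0≤g []       = ℚ.≤-refl
sum-nonneg 0≤g (x ∷ xs) = ℚ.+-mono-≤ (0≤g x) (sum-nonneg 0≤g xs)

-- If h exceeds g by at least c at every x with p x, then the sums differ by at
-- least c times the number of such x.
sum-gap : {A : Set} (p : A → Bool) {g h : A → ℚ} (c : ℚ) →
  (∀ x → g x ℚ.≤ h x) → (∀ x → T (p x) → c ℚ.+ g x ℚ.≤ h x) →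
  ∀ xs → c ℚ.* toℚ (length (filterᵇ p xs)) ℚ.+ sum g xs ℚ.≤ sum h xs
sum-gap p c g≤h gap [] = ℚ.≤-reflexive
  (trans (ℚ.+-identityʳ (c ℚ.* 0ℚ)) (ℚ.*-zeroʳ c))
sum-gap p {g} {h} c g≤h gap (x ∷ xs) with p x | gap x
... | false | _ = begin
  c ℚ.* ℓ ℚ.+ (g x ℚ.+ sum g xs)   ≡⟨ solve 3 (λ a b d → a :+ (b :+ d) := b :+ (a :+ d)) refl (c ℚ.* ℓ) (g x) (sum g xs) ⟩
  g x ℚ.+ (c ℚ.* ℓ ℚ.+ sum g xs)   ≤⟨ ℚ.+-mono-≤ (g≤h x) (sum-gap p c g≤h gap xs) ⟩
  h x ℚ.+ sum h xs                 ∎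
  where open ℚ.≤-Reasoning
        open +-*-Solver
        ℓ = toℚ (length (filterᵇ p xs))
... | true | gapₓ = begin
  c ℚ.* toℚ (ℕ.suc (length (filterᵇ p xs))) ℚ.+ (g x ℚ.+ sum g xs)
    ≡⟨ cong (λ z → c ℚ.* z ℚ.+ (g x ℚ.+ sum g xs)) (toℚ-suc (length (filterᵇ p xs))) ⟩
  c ℚ.* (1ℚ ℚ.+ ℓ) ℚ.+ (g x ℚ.+ sum g xs)
    ≡⟨ solve 4 (λ c ℓ b d → c :* (con 1ℚ :+ ℓ) :+ (b :+ d) := (c :+ b) :+ (c :* ℓ :+ d)) refl c ℓ (g x) (sum g xs) ⟩
  (c ℚ.+ g x) ℚ.+ (c ℚ.* ℓ ℚ.+ sum g xs)
    ≤⟨ ℚ.+-mono-≤ (gapₓ tt) (sum-gap p c g≤h gap xs) ⟩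
  h x ℚ.+ sum h xs ∎
  where open ℚ.≤-Reasoning
        open +-*-Solver
        ℓ = toℚ (length (filterᵇ p xs))

-- The order of the real numbers

-- The order on sequences term by term, which is finer than that on reals.
infix 4 _≤ᵗ_

_≤ᵗ_ : ℝ → ℝ → Set
x ≤ᵗ y = ∀ i → seq x i ℚ.≤ seq y i

≤ᵗ⇒≤ : ∀ x y → x ≤ᵗ y → x ≤ y
≤ᵗ⇒≤ x y x≤y ε 0<ε = 0 , λ i _ → ℚ.≤-trans (x≤y i)
  (subst (ℚ._≤ seq y i ℚ.+ ε) (ℚ.+-identityʳ (seq y i))
    (ℚ.+-monoʳ-≤ (seq y i) (ℚ.<⇒≤ 0<ε)))

≤-trans : ∀ x y z → x ≤ y → y ≤ z → x ≤ z
≤-trans x y z x≤y y≤z ε 0<ε =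
  let 0<½ε  = 0<p*q (ℚ.positive⁻¹ ½) 0<ε
      M , h = x≤y (½ ℚ.* ε) 0<½ε
      N , k = y≤z (½ ℚ.* ε) 0<½ε
  in M ℕ.⊔ N , λ i i≥ → begin
    seq x i
      ≤⟨ h i (ℕ.m⊔n≤o⇒m≤o M N i≥) ⟩
    seq y i ℚ.+ ½ ℚ.* ε
      ≤⟨ ℚ.+-monoˡ-≤ (½ ℚ.* ε) (k i (ℕ.m⊔n≤o⇒n≤o M N i≥)) ⟩
    seq z i ℚ.+ ½ ℚ.* ε ℚ.+ ½ ℚ.* ε
      ≡⟨ trans (ℚ.+-assoc (seq z i) _ _) (cong (seq z i ℚ.+_) (½ε+½ε≡ε ε)) ⟩
    seq z i ℚ.+ ε ∎
  where open ℚ.≤-Reasoning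

+-mono-≤ : ∀ x y z t → x ≤ y → z ≤ t → x + z ≤ y + t
+-mono-≤ x y z t x≤y z≤t ε 0<ε =
  let 0<½ε  = 0<p*q (ℚ.positive⁻¹ ½) 0<ε
      M , h = x≤y (½ ℚ.* ε) 0<½ε
      N , k = z≤t (½ ℚ.* ε) 0<½ε
  in M ℕ.⊔ N , λ i i≥ → begin
    seq x i ℚ.+ seq z i
      ≤⟨ ℚ.+-mono-≤ (h i (ℕ.m⊔n≤o⇒m≤o M N i≥)) (k i (ℕ.m⊔n≤o⇒n≤o M N i≥)) ⟩
    (seq y i ℚ.+ ½ ℚ.* ε) ℚ.+ (seq t i ℚ.+ ½ ℚ.* ε)
      ≡⟨ solve 3 (λ a b h → (a :+ h) :+ (b :+ h) := (a :+ b) :+ (h :+ h)) refl (seq y i) (seq t i) (½ ℚ.* ε) ⟩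
    (seq y i ℚ.+ seq t i) ℚ.+ (½ ℚ.* ε ℚ.+ ½ ℚ.* ε)
      ≡⟨ cong ((seq y i ℚ.+ seq t i) ℚ.+_) (½ε+½ε≡ε ε) ⟩
    (seq y i ℚ.+ seq t i) ℚ.+ ε ∎
  where open ℚ.≤-Reasoning
        open +-*-Solver

⊓-glb : ∀ x y z → z ≤ x → z ≤ y → z ≤ x ⊓ y
⊓-glb x y z z≤x z≤y ε 0<ε =
  let M , h = z≤x ε 0<ε
      N , k = z≤y ε 0<ε
  in M ℕ.⊔ N , λ i i≥ → bound i
       (h i (ℕ.m⊔n≤o⇒m≤o M N i≥)) (k i (ℕ.m⊔n≤o⇒n≤o M N i≥))
  where
  bound : ∀ i → seq z i ℚ.≤ seq x i ℚ.+ ε → seq z i ℚ.≤ seq y i ℚ.+ ε →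
          seq z i ℚ.≤ seq x i ℚ.⊓ seq y i ℚ.+ ε
  bound i h k with ℚ.⊓-sel (seq x i) (seq y i)
  ... | inj₁ e = subst (λ r → seq z i ℚ.≤ r ℚ.+ ε) (sym e) h
  ... | inj₂ e = subst (λ r → seq z i ℚ.≤ r ℚ.+ ε) (sym e) k

⊔-lub : ∀ x y z → x ≤ z → y ≤ z → x ⊔ y ≤ z
⊔-lub x y z x≤z y≤z ε 0<ε =
  let M , h = x≤z ε 0<ε
      N , k = y≤z ε 0<ε
  in M ℕ.⊔ N , λ i i≥ → ℚ.⊔-lub
       (h i (ℕ.m⊔n≤o⇒m≤o M N i≥)) (k i (ℕ.m⊔n≤o⇒n≤o M N i≥))

bounded-above : ∀ x →
  ∃[ K ] (0ℚ ℚ.< K × ∃[ N ] (∀ i → N ℕ.≤ i → seq x i ℚ.≤ K))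
bounded-above x with cauchy x 1ℚ (ℚ.positive⁻¹ 1ℚ)
... | N , h = 1ℚ ℚ.+ ∣ a ∣
  , ℚ.+-mono-<-≤ (ℚ.positive⁻¹ 1ℚ) (ℚ.nonNegative⁻¹ ∣ a ∣ {{ℚ.∣-∣-nonNeg a}})
  , N , λ i i≥ → begin
    seq x i                    ≡⟨ solve 2 (λ b c → b := (b :- c) :+ c) refl (seq x i) a ⟩
    (seq x i ℚ.- a) ℚ.+ a      ≤⟨ ℚ.+-mono-≤ (ℚ.≤-trans (p≤∣p∣ _) (h i N i≥ ℕ.≤-refl)) (p≤∣p∣ a) ⟩
    1ℚ ℚ.+ ∣ a ∣               ∎
  where
  open ℚ.≤-Reasoning
  open +-*-Solver
  a = seq x N
  p≤∣p∣ : ∀ p → p ℚ.≤ ∣ p ∣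
  p≤∣p∣ p with ℚ.≤-total 0ℚ p
  ... | inj₁ 0≤p = ℚ.≤-reflexive (sym (ℚ.0≤p⇒∣p∣≡p 0≤p))
  ... | inj₂ p≤0 = ℚ.≤-trans p≤0 (ℚ.nonNegative⁻¹ ∣ p ∣ {{ℚ.∣-∣-nonNeg p}})

-- If d and z lie between -δ and K, then d * z ≥ - δ * K.
product-lower-bound : ∀ {d z δ K} → 0ℚ ℚ.≤ δ → 0ℚ ℚ.≤ K →
  0ℚ ℚ.≤ d ℚ.+ δ → 0ℚ ℚ.≤ z ℚ.+ δ → d ℚ.≤ K → z ℚ.≤ K →
  0ℚ ℚ.≤ d ℚ.* z ℚ.+ δ ℚ.* K
product-lower-bound {d} {z} {δ} {K} 0≤δ 0≤K 0≤d+δ 0≤z+δ d≤K z≤K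
  with ℚ.≤-total 0ℚ z | ℚ.≤-total 0ℚ d
... | inj₁ 0≤z | _ = subst (0ℚ ℚ.≤_)
  (solve 4 (λ d z δ K → (d :+ δ) :* z :+ δ :* (K :- z) := d :* z :+ δ :* K) refl d z δ K)
  (ℚ.+-mono-≤ (0≤p*q 0≤d+δ 0≤z) (0≤p*q 0≤δ (0≤q-p z≤K)))
  where open +-*-Solver
... | inj₂ _ | inj₁ 0≤d = subst (0ℚ ℚ.≤_)
  (solve 4 (λ d z δ K → d :* (z :+ δ) :+ δ :* (K :- d) := d :* z :+ δ :* K) refl d z δ K)
  (ℚ.+-mono-≤ (0≤p*q 0≤d 0≤z+δ) (0≤p*q 0≤δ (0≤q-p d≤K)))
  where open +-*-Solver
... | inj₂ z≤0 | inj₂ d≤0 = subst (0ℚ ℚ.≤_)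
  (solve 4 (λ d z δ K → (con 0ℚ :- d) :* (con 0ℚ :- z) :+ δ :* K := d :* z :+ δ :* K) refl d z δ K)
  (ℚ.+-mono-≤ (0≤p*q (0≤q-p d≤0) (0≤q-p z≤0)) (0≤p*q 0≤δ 0≤K))
  where open +-*-Solver

-- With difference = y - x, the product difference * z is bounded below by
-- - ε: both factors are eventually at most K and at least - ε / K.
*-monoˡ-≤ : ∀ x y z → 0ℝ ≤ z → x ≤ y → x * z ≤ y * z
*-monoˡ-≤ x y z 0≤z x≤y ε 0<ε =
  let K , 0<K , L , upper = bounded-above (difference ⊔ z)
      instance
        K-pos : ℚ.Positive K
        K-pos = ℚ.positive 0<K
        K-nonZero : ℚ.NonZero K
        K-nonZero = ℚ.pos⇒nonZero K
      δ     = ε ℚ.* 1/ K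
      0<δ   = 0<p*q 0<ε (ℚ.positive⁻¹ (1/ K) {{ℚ.1/pos⇒pos K}})
      M , h = x≤y δ 0<δ
      N , k = 0≤z δ 0<δ
      δK≡ε  = trans (ℚ.*-assoc ε (1/ K) K)
                (trans (cong (ε ℚ.*_) (ℚ.*-inverseˡ K)) (ℚ.*-identityʳ ε))
  in L ℕ.⊔ (M ℕ.⊔ N) , λ i i≥ →
    let i≥L = ℕ.m⊔n≤o⇒m≤o L (M ℕ.⊔ N) i≥
        i≥M = ℕ.m⊔n≤o⇒m≤o M N (ℕ.m⊔n≤o⇒n≤o L (M ℕ.⊔ N) i≥)
        i≥N = ℕ.m⊔n≤o⇒n≤o M N (ℕ.m⊔n≤o⇒n≤o L (M ℕ.⊔ N) i≥)
        d   = seq difference i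
    in term i δK≡ε (product-lower-bound {d} {seq z i} {δ} {K}
         (ℚ.<⇒≤ 0<δ) (ℚ.<⇒≤ 0<K) (shift i (h i i≥M)) (k i i≥N)
         (ℚ.≤-trans (ℚ.p≤p⊔q d (seq z i)) (upper i i≥L))
         (ℚ.≤-trans (ℚ.p≤q⊔p d (seq z i)) (upper i i≥L)))
  where
  open +-*-Solver
  difference : ℝ
  difference = y + fromℚ (ℚ.- 1ℚ) * x

  shift : ∀ i {δ} → seq x i ℚ.≤ seq y i ℚ.+ δ → 0ℚ ℚ.≤ seq difference i ℚ.+ δ
  shift i {δ} h = subst (0ℚ ℚ.≤_)
    (solve 3 (λ x y δ → y :+ δ :- x := y :+ con (ℚ.- 1ℚ) :* x :+ δ) refl (seq x i) (seq y i) δ)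
    (0≤q-p h)

  term : ∀ i {η} → η ≡ ε → 0ℚ ℚ.≤ seq difference i ℚ.* seq z i ℚ.+ η →
         seq x i ℚ.* seq z i ℚ.≤ seq y i ℚ.* seq z i ℚ.+ ε
  term i {η} refl h = subst₂ ℚ._≤_
    (ℚ.+-identityʳ (seq x i ℚ.* seq z i))
    (solve 4 (λ x y z η → x :* z :+ ((y :+ con (ℚ.- 1ℚ) :* x) :* z :+ η) := y :* z :+ η) refl (seq x i) (seq y i) (seq z i) η)
    (ℚ.+-monoʳ-≤ (seq x i ℚ.* seq z i) h)

*-comm-≤ : ∀ x y → x * y ≤ y * x
*-comm-≤ x y = ≤ᵗ⇒≤ (x * y) (y * x) λ i → ℚ.≤-reflexive (ℚ.*-comm (seq x i) (seq y i))

*-monoʳ-≤ : ∀ x y z → 0ℝ ≤ z → x ≤ y → z * x ≤ z * y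
*-monoʳ-≤ x y z 0≤z x≤y =
  ≤-trans (z * x) (x * z) (z * y) (*-comm-≤ z x)
    (≤-trans (x * z) (y * z) (z * y) (*-monoˡ-≤ x y z 0≤z x≤y) (*-comm-≤ y z))

*-nonneg : ∀ x y → 0ℝ ≤ x → 0ℝ ≤ y → 0ℝ ≤ x * y
*-nonneg x y 0≤x 0≤y = ≤-trans 0ℝ (0ℝ * y) (x * y)
  (≤ᵗ⇒≤ 0ℝ (0ℝ * y) λ i → ℚ.≤-reflexive (sym (ℚ.*-zeroˡ (seq y i))))
  (*-monoˡ-≤ 0ℝ x y 0≤y 0≤x)

+-nonneg : ∀ x y → 0ℝ ≤ x → 0ℝ ≤ y → 0ℝ ≤ x + y
+-nonneg x y = +-mono-≤ 0ℝ x 0ℝ y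

0≤fromℚ : ∀ {q} → 0ℚ ℚ.≤ q → 0ℝ ≤ fromℚ q
0≤fromℚ {q} 0≤q = ≤ᵗ⇒≤ 0ℝ (fromℚ q) λ _ → 0≤q

*-≤-fromℚ : ∀ x y {p q} → 0ℚ ℚ.≤ p → 0ℝ ≤ y → x ≤ fromℚ p → y ≤ fromℚ q →
  x * y ≤ fromℚ (p ℚ.* q)
*-≤-fromℚ x y {p} {q} 0≤p 0≤y x≤p y≤q =
  ≤-trans (x * y) (fromℚ p * y) (fromℚ (p ℚ.* q))
    (*-monoˡ-≤ x (fromℚ p) y 0≤y x≤p)
    (*-monoʳ-≤ y (fromℚ q) (fromℚ p) (0≤fromℚ 0≤p) y≤q)

-- Sums, minima and maxima are right folds of families of reals. They inherit
-- monotonicity, and closure of a predicate, from the folded operation.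
foldr-map-mono : {A B : Set} (_∼_ : B → B → Set) {_∙_ : B → B → B} →
  (∀ a b c d → a ∼ b → c ∼ d → (a ∙ c) ∼ (b ∙ d)) →
  ∀ {y z} → y ∼ z → {g h : A → B} → (∀ x → g x ∼ h x) →
  ∀ xs → foldr _∙_ y (map g xs) ∼ foldr _∙_ z (map h xs)
foldr-map-mono _∼_ mono y∼z g∼h []       = y∼z
foldr-map-mono _∼_ mono y∼z g∼h (x ∷ xs) =
  mono _ _ _ _ (g∼h x) (foldr-map-mono _∼_ mono y∼z g∼h xs)

foldr-map-pred : {A B : Set} (P : B → Set) {_∙_ : B → B → B} →
  (∀ a b → P a → P b → P (a ∙ b)) →
  ∀ {z} → P z → {g : A → B} → (∀ x → P (g x)) →
  ∀ xs → P (foldr _∙_ z (map g xs))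
foldr-map-pred P closed Pz Pg []       = Pz
foldr-map-pred P closed Pz Pg (x ∷ xs) =
  closed _ _ (Pg x) (foldr-map-pred P closed Pz Pg xs)

foldr-⊓-lower : {A : Set} {P : A → Set} (i : ℕ) (g : A → ℝ) (z : ℝ) {b : ℚ} →
  (∀ x → P x → seq (g x) i ℚ.≤ b) →
  ∀ {xs} → Any P xs → seq (foldr _⊓_ z (map g xs)) i ℚ.≤ b
foldr-⊓-lower i g z bound {x ∷ xs} (here px) = ℚ.≤-trans
  (ℚ.p⊓q≤p (seq (g x) i) (seq (foldr _⊓_ z (map g xs)) i)) (bound x px)
foldr-⊓-lower i g z bound {x ∷ xs} (there h) = ℚ.≤-trans
  (ℚ.p⊓q≤q (seq (g x) i) (seq (foldr _⊓_ z (map g xs)) i))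
  (foldr-⊓-lower i g z bound h)

-- At a fixed index a finite minimum is attained, by a member of the family
-- that may change with the index.
foldr-⊓-sel : {A : Set} (i : ℕ) (g : A → ℝ) (x₀ : A) (xs : List A) →
  ∃[ x ] (seq (foldr _⊓_ (g x₀) (map g xs)) i ≡ seq (g x) i)
foldr-⊓-sel i g x₀ [] = x₀ , refl
foldr-⊓-sel i g x₀ (x ∷ xs) =
  case ℚ.⊓-sel (seq (g x) i) (seq (foldr _⊓_ (g x₀) (map g xs)) i) of λ where
    (inj₁ e) → x , e
    (inj₂ e) → let y , e′ = foldr-⊓-sel i g x₀ xs in y , trans e e′

∑-≤-fromℚ : {A : Set} (g : A → ℝ) (q : ℚ) → (∀ x → g x ≤ fromℚ q) →
  ∀ xs → ∑ (map g xs) ≤ fromℚ (toℚ (length xs) ℚ.* q)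
∑-≤-fromℚ g q g≤q [] = ≤ᵗ⇒≤ 0ℝ (fromℚ (0ℚ ℚ.* q)) λ _ →
  ℚ.≤-reflexive (sym (ℚ.*-zeroˡ q))
∑-≤-fromℚ g q g≤q (x ∷ xs) = ≤-trans (g x + ∑ (map g xs)) (fromℚ q + fromℚ (ℓ ℚ.* q))
  (fromℚ (toℚ (ℕ.suc (length xs)) ℚ.* q))
  (+-mono-≤ (g x) (fromℚ q) (∑ (map g xs)) (fromℚ (ℓ ℚ.* q)) (g≤q x) (∑-≤-fromℚ g q g≤q xs))
  (≤ᵗ⇒≤ (fromℚ q + fromℚ (ℓ ℚ.* q)) (fromℚ (toℚ (ℕ.suc (length xs)) ℚ.* q)) λ _ → ℚ.≤-reflexive
    (trans (solve 2 (λ q ℓ → q :+ ℓ :* q := (con 1ℚ :+ ℓ) :* q) refl q ℓ)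
           (cong (ℚ._* q) (sym (toℚ-suc (length xs))))))
  where open +-*-Solver
        ℓ = toℚ (length xs)

seq-∑ : {A : Set} (g : A → ℝ) (i : ℕ) → ∀ xs →
  seq (∑ (map g xs)) i ≡ sum (λ x → seq (g x) i) xs
seq-∑ g i []       = refl
seq-∑ g i (x ∷ xs) = cong (seq (g x) i ℚ.+_) (seq-∑ g i xs)

-- Weighted distances, one index at a time

edge-end₁-end₂ : ∀ {n} (H : Graph n) (e : Edge H)
  (uv : Adj H (Edge.end₁ e) (Edge.end₂ e)) → edge H uv ≡ e
edge-end₁-end₂ H (mkEdge u v u<v _) uv with Fin.<-cmp u v
... | tri< _ _ _    = refl
... | tri≈ u≮v _ _  = contradiction-irr u<v u≮v
... | tri> u≮v _ _  = contradiction-irr u<v u≮v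

edge-end₂-end₁ : ∀ {n} (H : Graph n) (e : Edge H)
  (vu : Adj H (Edge.end₂ e) (Edge.end₁ e)) → edge H vu ≡ e
edge-end₂-end₁ H (mkEdge u v u<v _) vu with Fin.<-cmp v u
... | tri< _ _ v≯u  = contradiction-irr u<v v≯u
... | tri≈ _ _ v≯u  = contradiction-irr u<v v≯u
... | tri> _ _ _    = refl

module _ {n} {H : Graph n} (w : WeightFunction H) (i : ℕ) where

  -- The i-th terms of the sequences for weights, path weights and distances.
  weightᵢ : Edge H → ℚ
  weightᵢ e = seq (weight w e) i

  pathWeightᵢ : ∀ {u v} → Path H u v → ℚ
  pathWeightᵢ p = seq (pathWeight w p) i

  distanceᵢ : Connected H → Fin n → Fin n → ℚ
  distanceᵢ c u v = seq (distance w c u v) i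

  distance≤pathWeight : ∀ c {u v} (p : Path H u v) → distanceᵢ c u v ℚ.≤ pathWeightᵢ p
  distance≤pathWeight c {u} {v} p =
    foldr-⊓-lower i (pathWeight w) (pathWeight w (Connected.path c u v))
      (λ q e → ℚ.≤-reflexive (same q e)) (paths-complete H p)
    where
    -- The weight of a path depends on its list of vertices only.
    same : (q : Path H u v) → Path.vertices q ≡ Path.vertices p →
           pathWeightᵢ q ≡ pathWeightᵢ p
    same (mkPath xs _ _ l _) refl = cong (λ l → seq (linkedWeight w {xs} l) i)
      (Linked.irrelevant T-irrelevant l (Path.linked p))

  distance-attained : ∀ c u v → ∃[ p ] (distanceᵢ c u v ≡ pathWeightᵢ {u} {v} p)
  distance-attained c u v =
    foldr-⊓-sel i (pathWeight w) (Connected.path c u v) (paths H u v)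

  distance-self≤0 : ∀ c v → distanceᵢ c v v ℚ.≤ 0ℚ
  distance-self≤0 c v = distance≤pathWeight c {v} {v}
    (mkPath (v ∷ []) refl refl [-] (All.[] AllPairs.∷ AllPairs.[]))

  module _ (weightᵢ≥0 : ∀ e → 0ℚ ℚ.≤ weightᵢ e) where

    -- The part of a path from one of its vertices on.
    suffix : ∀ {x v xs} → x ∈ xs → last xs ≡ just v →
      (l : Linked (Adj H) xs) → Unique xs →
      ∃[ p ] (pathWeightᵢ {x} {v} p ℚ.≤ seq (linkedWeight w l) i)
    suffix {xs = xs} (here refl) e l q = mkPath xs refl e l q , ℚ.≤-refl
    suffix {xs = _ ∷ _ ∷ _} (there x∈xs) e (ab ∷ l) (_ AllPairs.∷ q) =
      let p , p≤l = suffix x∈xs e l q in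
      p , ℚ.≤-trans (ℚ.≤-reflexive (sym (ℚ.+-identityˡ (pathWeightᵢ p))))
                    (ℚ.+-mono-≤ (weightᵢ≥0 (edge H ab)) p≤l)

    -- If x already lies on the path, the rest of the path from x on is used
    -- instead of the extended vertex list, which would repeat x.
    extend : ∀ {x y v} (xy : Adj H x y) (p : Path H y v) →
      ∃[ q ] (pathWeightᵢ {x} {v} q ℚ.≤ weightᵢ (edge H xy) ℚ.+ pathWeightᵢ p)
    extend {x} xy (mkPath (y ∷ ys) refl e l q) with x ∈? (y ∷ ys)
      where open DecMembership (Fin._≟_ {n}) using (_∈?_)
    ... | yes x∈ =
      let p , p≤l = suffix x∈ e l q in
      p , ℚ.≤-trans (ℚ.≤-reflexive (sym (ℚ.+-identityˡ (pathWeightᵢ p))))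
                    (ℚ.+-mono-≤ (weightᵢ≥0 (edge H xy)) p≤l)
    ... | no x∉ =
      mkPath (x ∷ y ∷ ys) refl e (xy ∷ l) (¬Any⇒All¬ (y ∷ ys) x∉ AllPairs.∷ q)
      , ℚ.≤-refl

    distance-step : ∀ c {x y} v (xy : Adj H x y) →
      distanceᵢ c x v ℚ.≤ weightᵢ (edge H xy) ℚ.+ distanceᵢ c y v
    distance-step c {x} {y} v xy =
      let p , d≡p = distance-attained c y v
          q , q≤  = extend xy p
      in ℚ.≤-trans (distance≤pathWeight c q)
           (subst (λ d → pathWeightᵢ q ℚ.≤ weightᵢ (edge H xy) ℚ.+ d) (sym d≡p) q≤)

    distance-lipschitz : ∀ c v (e : Edge H) →
      distanceᵢ c (Edge.end₁ e) v ℚ.≤ weightᵢ e ℚ.+ distanceᵢ c (Edge.end₂ e) v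
      × distanceᵢ c (Edge.end₂ e) v ℚ.≤ weightᵢ e ℚ.+ distanceᵢ c (Edge.end₁ e) v
    distance-lipschitz c v e@(mkEdge x y _ xy-irr) =
      subst (λ e → distanceᵢ c x v ℚ.≤ weightᵢ e ℚ.+ distanceᵢ c y v)
        (edge-end₁-end₂ H e xy) (distance-step c v xy)
      , subst (λ e → distanceᵢ c y v ℚ.≤ weightᵢ e ℚ.+ distanceᵢ c x v)
        (edge-end₂-end₁ H e yx) (distance-step c v yx)
      where
      xy : Adj H x y
      xy = recompute (T? (adj H x y)) xy-irr
      yx : Adj H y x
      yx = subst T (adj-sym H x y) xy

-- Cuts

module _ {n} (H : Graph n) (S : Fin n → Bool) where

  -- The edges of H with exactly one end in S.
  cut : Graph n
  cut = record
    { adj        = λ x y → adj H x y ∧ (S x xor S y)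
    ; adj-sym    = λ x y → cong₂ _∧_ (adj-sym H x y) (xor-comm (S x) (S y))
    ; adj-irrefl = λ x → cong (_∧ (S x xor S x)) (adj-irrefl H x)
    }

  crosses : Edge H → Bool
  crosses e = S (Edge.end₁ e) xor S (Edge.end₂ e)

  numEdges-cut : numEdges cut ≡ length (filterᵇ crosses (edges H))
  numEdges-cut = go (cartesianProduct (allFin n) (allFin n))
    where
    go : ∀ ps → length (mapMaybe (edge? cut) ps)
              ≡ length (filterᵇ crosses (mapMaybe (edge? H) ps))
    go [] = refl
    go ((x , y) ∷ ps) with x Fin.<? y | T? (adj H x y) | T? (adj H x y ∧ (S x xor S y))
    ... | no _  | _      | _      = go ps
    ... | yes _ | no ¬xy | yes c  =
      contradiction (proj₁ (Equivalence.to T-∧ c)) ¬xy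
    ... | yes _ | no _   | no _   = go ps
    ... | yes x<y | yes xy | yes c = trans (cong ℕ.suc (go ps))
      (sym (cong length (filter-accept (λ e → T? (crosses e)) {x = mkEdge x y x<y xy}
        (proj₂ (Equivalence.to (T-∧ {x = adj H x y}) c)))))
    ... | yes x<y | yes xy | no ¬c = trans (go ps)
      (sym (cong length (filter-reject (λ e → T? (crosses e)) {x = mkEdge x y x<y xy}
        (λ d → ¬c (Equivalence.from T-∧ (xy , d))))))

  cut-disconnects : ∀ {u v} → S u ≡ true → S v ≡ false → Disconnects cut H
  cut-disconnects {u} {v} Su Sv =
    (λ x y c → proj₁ (Equivalence.to T-∧ c)) ,
    λ connected → absurd (Connected.path connected u v)
    where
    stays : ∀ {x y} → Adj (H ∖ cut) x y → S x ≡ S y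
    stays {x} {y} h with adj H x y | S x | S y
    ... | true | true  | true  = refl
    ... | true | false | false = refl

    constant : ∀ {x y} xs → head xs ≡ just x → last xs ≡ just y →
               Linked (Adj (H ∖ cut)) xs → S x ≡ S y
    constant (x ∷ [])     refl refl _       = refl
    constant (x ∷ y ∷ xs) refl e    (h ∷ l) = trans (stays h) (constant (y ∷ xs) refl e l)

    absurd : ¬ Path (H ∖ cut) u v
    absurd (mkPath xs s e l _) with trans (sym Su) (trans (constant xs s e l) Sv)
    ... | ()

-- The co-area inequality

-- The length of the part of the interval between p and q that lies above s.
rise : ℚ → ℚ → ℚ → ℚ
rise s p q = (p ℚ.⊔ q ℚ.⊔ s) ℚ.- (p ℚ.⊓ q ℚ.⊔ s)

⊔-nonexpansive : ∀ {l h} s → l ℚ.≤ h → (h ℚ.⊔ s) ℚ.- (l ℚ.⊔ s) ℚ.≤ h ℚ.- l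
⊔-nonexpansive {l} {h} s l≤h = begin
  (h ℚ.⊔ s) ℚ.- (l ℚ.⊔ s)
    ≤⟨ ℚ.+-monoˡ-≤ (ℚ.- (l ℚ.⊔ s)) (ℚ.⊔-lub h≤ s≤) ⟩
  ((l ℚ.⊔ s) ℚ.+ (h ℚ.- l)) ℚ.- (l ℚ.⊔ s)
    ≡⟨ solve 2 (λ a b → (a :+ b) :- a := b) refl (l ℚ.⊔ s) (h ℚ.- l) ⟩
  h ℚ.- l ∎
  where
  open ℚ.≤-Reasoning
  open +-*-Solver
  h≤ : h ℚ.≤ (l ℚ.⊔ s) ℚ.+ (h ℚ.- l)
  h≤ = ℚ.≤-trans
    (ℚ.≤-reflexive (solve 2 (λ l h → h := l :+ (h :- l)) refl l h))
    (ℚ.+-monoˡ-≤ (h ℚ.- l) (ℚ.p≤p⊔q l s))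
  s≤ : s ℚ.≤ (l ℚ.⊔ s) ℚ.+ (h ℚ.- l)
  s≤ = ℚ.≤-trans (ℚ.≤-reflexive (sym (ℚ.+-identityʳ s)))
    (ℚ.+-mono-≤ (ℚ.p≤q⊔p l s) (0≤q-p l≤h))

⊓≤⊔ : ∀ p q → p ℚ.⊓ q ℚ.≤ p ℚ.⊔ q
⊓≤⊔ p q = ℚ.≤-trans (ℚ.p⊓q≤p p q) (ℚ.p≤p⊔q p q)

0≤rise : ∀ s p q → 0ℚ ℚ.≤ rise s p q
0≤rise s p q = 0≤q-p (ℚ.⊔-monoˡ-≤ s (⊓≤⊔ p q))

rise-antitone : ∀ {s t} p q → s ℚ.≤ t → rise t p q ℚ.≤ rise s p q
rise-antitone {s} {t} p q s≤t = subst (ℚ._≤ rise s p q)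
  (cong₂ ℚ._-_ (absorb (p ℚ.⊔ q)) (absorb (p ℚ.⊓ q)))
  (⊔-nonexpansive t (ℚ.⊔-monoˡ-≤ s (⊓≤⊔ p q)))
  where
  absorb : ∀ a → (a ℚ.⊔ s) ℚ.⊔ t ≡ a ℚ.⊔ t
  absorb a = trans (ℚ.⊔-assoc a s t) (cong (a ℚ.⊔_) (ℚ.p≤q⇒p⊔q≡q s≤t))

rise-comm : ∀ s p q → rise s p q ≡ rise s q p
rise-comm s p q = cong₂ (λ a b → (a ℚ.⊔ s) ℚ.- (b ℚ.⊔ s)) (ℚ.⊔-comm p q) (ℚ.⊓-comm p q)

rise-gap : ∀ {s t} p q → p ℚ.≤ s → s ℚ.≤ t → t ℚ.≤ q →
  (t ℚ.- s) ℚ.+ rise t p q ℚ.≤ rise s p q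
rise-gap {s} {t} p q p≤s s≤t t≤q = begin
  (t ℚ.- s) ℚ.+ rise t p q
    ≡⟨ cong₂ (λ a b → (t ℚ.- s) ℚ.+ (a ℚ.- b)) (top t t≤q) (bottom t (ℚ.≤-trans p≤s s≤t)) ⟩
  (t ℚ.- s) ℚ.+ (q ℚ.- t)
    ≡⟨ solve 3 (λ s t q → (t :- s) :+ (q :- t) := q :- s) refl s t q ⟩
  q ℚ.- s
    ≡⟨ sym (cong₂ ℚ._-_ (top s (ℚ.≤-trans s≤t t≤q)) (bottom s p≤s)) ⟩
  rise s p q ∎
  where
  open ℚ.≤-Reasoning
  open +-*-Solver
  p≤q : p ℚ.≤ q
  p≤q = ℚ.≤-trans p≤s (ℚ.≤-trans s≤t t≤q)
  top : ∀ r → r ℚ.≤ q → p ℚ.⊔ q ℚ.⊔ r ≡ q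
  top r r≤q = trans (cong (ℚ._⊔ r) (ℚ.p≤q⇒p⊔q≡q p≤q)) (ℚ.p≥q⇒p⊔q≡p r≤q)
  bottom : ∀ r → p ℚ.≤ r → p ℚ.⊓ q ℚ.⊔ r ≡ r
  bottom r p≤r = trans (cong (ℚ._⊔ r) (ℚ.p≤q⇒p⊓q≡p p≤q)) (ℚ.p≤q⇒p⊔q≡q p≤r)

rise≤ : ∀ {s p q ω} → p ℚ.≤ ω ℚ.+ q → q ℚ.≤ ω ℚ.+ p → rise s p q ℚ.≤ ω
rise≤ {s} {p} {q} {ω} p≤ q≤ = ℚ.≤-trans (⊔-nonexpansive s (⊓≤⊔ p q)) difference
  where
  open +-*-Solver
  subtract : ∀ {a b} → a ℚ.≤ ω ℚ.+ b → a ℚ.- b ℚ.≤ ω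
  subtract {a} {b} h = ℚ.≤-trans (ℚ.+-monoˡ-≤ (ℚ.- b) h)
    (ℚ.≤-reflexive (solve 2 (λ ω b → ω :+ b :- b := ω) refl ω b))
  difference : (p ℚ.⊔ q) ℚ.- (p ℚ.⊓ q) ℚ.≤ ω
  difference with ℚ.≤-total p q
  ... | inj₁ p≤q = subst (ℚ._≤ ω)
    (sym (cong₂ ℚ._-_ (ℚ.p≤q⇒p⊔q≡q p≤q) (ℚ.p≤q⇒p⊓q≡p p≤q))) (subtract q≤)
  ... | inj₂ q≤p = subst (ℚ._≤ ω)
    (sym (cong₂ ℚ._-_ (ℚ.p≥q⇒p⊔q≡p q≤p) (ℚ.p≥q⇒p⊓q≡q q≤p))) (subtract p≤)

module _ {n} (H : Graph n) {k} (k-minimal : ∀ F → Disconnects F H → k ℕ.≤ numEdges F)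
         (f : Fin n → ℚ) (u v : Fin n) where

  -- The rise of f along an edge above level t.
  riseₑ : ℚ → Edge H → ℚ
  riseₑ t e = rise t (f (Edge.end₁ e)) (f (Edge.end₂ e))

  -- The level set { x | t < f x }.
  above : ℚ → Fin n → Bool
  above t x = ⌊ t ℚ.<? f x ⌋

  k≤cut-above : ∀ {t} → f v ℚ.≤ t → t ℚ.< f u →
    k ℕ.≤ length (filterᵇ (crosses H (above t)) (edges H))
  k≤cut-above {t} fv≤t t<fu = subst (k ℕ.≤_) (numEdges-cut H (above t))
    (k-minimal _ (cut-disconnects H (above t) u-above v-below))
    where
    u-above : above t u ≡ true
    u-above with t ℚ.<? f u
    ... | yes _   = refl
    ... | no t≮fu = contradiction t<fu t≮fu
    v-below : above t v ≡ false
    v-below with t ℚ.<? f v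
    ... | yes t<fv = contradiction (ℚ.<-≤-trans t<fv fv≤t) (ℚ.<-irrefl refl)
    ... | no _     = refl

  -- No value of f lies strictly between t and a, so along an edge of the cut
  -- f rises from at most t to at least a.
  crosses-gap : ∀ {t a} → t ℚ.≤ a → (∀ x → t ℚ.< f x → a ℚ.≤ f x) →
    ∀ e → T (crosses H (above t) e) → (a ℚ.- t) ℚ.+ riseₑ a e ℚ.≤ riseₑ t e
  crosses-gap {t} {a} t≤a above⇒≥a (mkEdge x y _ _) h
    with t ℚ.<? f x | t ℚ.<? f y
  ... | yes t<fx | no t≮fy = subst₂ (λ p q → (a ℚ.- t) ℚ.+ p ℚ.≤ q)
    (rise-comm a (f y) (f x)) (rise-comm t (f y) (f x))
    (rise-gap (f y) (f x) (ℚ.≮⇒≥ t≮fy) t≤a (above⇒≥a x t<fx))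
  ... | no t≮fx | yes t<fy =
    rise-gap (f x) (f y) (ℚ.≮⇒≥ t≮fx) t≤a (above⇒≥a y t<fy)

  below-trivial : ∀ {t} → f u ℚ.≤ t →
    (f u ℚ.- t) ℚ.* toℚ k ℚ.≤ sum (riseₑ t) (edges H)
  below-trivial {t} fu≤t = ℚ.≤-trans
    (ℚ.*-monoʳ-≤-nonNeg (toℚ k) {{ℚ.nonNegative (0≤fraction k 1)}}
      (ℚ.≤-trans (ℚ.+-monoˡ-≤ (ℚ.- t) fu≤t) (ℚ.≤-reflexive (ℚ.+-inverseʳ t))))
    (ℚ.≤-trans (ℚ.≤-reflexive (ℚ.*-zeroˡ (toℚ k)))
      (sum-nonneg (λ e → 0≤rise t (f (Edge.end₁ e)) (f (Edge.end₂ e))) (edges H)))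

  -- All values of f above t occur in the increasing list ts. Moving the
  -- threshold from t to the next value a costs each of the at least k edges of
  -- the cut { f > t } an amount a - t.
  coarea : ∀ {ts} → AllPairs ℚ._≤_ ts → ∀ t →
    (∀ x → t ℚ.< f x → f x ∈ ts) → f v ℚ.≤ t →
    (f u ℚ.- t) ℚ.* toℚ k ℚ.≤ sum (riseₑ t) (edges H)
  coarea AllPairs.[] t values fv≤t = below-trivial (ℚ.≮⇒≥ none)
    where
    none : ¬ (t ℚ.< f u)
    none t<fu with values u t<fu
    ... | ()
  coarea {a ∷ ts} (a≤ts AllPairs.∷ sorted) t values fv≤t with t ℚ.<? a | t ℚ.<? f u
  ... | _ | no t≮fu = below-trivial (ℚ.≮⇒≥ t≮fu)
  ... | no t≮a | yes _ = coarea sorted t values′ fv≤t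
    where
    values′ : ∀ x → t ℚ.< f x → f x ∈ ts
    values′ x t<fx with values x t<fx
    ... | here fx≡a   = contradiction (subst (t ℚ.<_) fx≡a t<fx) t≮a
    ... | there fx∈ts = fx∈ts
  ... | yes t<a | yes t<fu = begin
    (f u ℚ.- t) ℚ.* toℚ k
      ≡⟨ solve 4 (λ u t a k → (u :- t) :* k := (a :- t) :* k :+ (u :- a) :* k) refl (f u) t a (toℚ k) ⟩
    (a ℚ.- t) ℚ.* toℚ k ℚ.+ (f u ℚ.- a) ℚ.* toℚ k
      ≤⟨ ℚ.+-mono-≤
           (ℚ.*-monoˡ-≤-nonNeg (a ℚ.- t) {{ℚ.nonNegative (0≤q-p t≤a)}}
             (toℚ-mono-≤ (k≤cut-above fv≤t t<fu)))
           (coarea sorted a values′ (ℚ.≤-trans fv≤t t≤a)) ⟩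
    (a ℚ.- t) ℚ.* toℚ (length (filterᵇ (crosses H (above t)) (edges H)))
      ℚ.+ sum (riseₑ a) (edges H)
      ≤⟨ sum-gap (crosses H (above t)) (a ℚ.- t)
           (λ e → rise-antitone (f (Edge.end₁ e)) (f (Edge.end₂ e)) t≤a)
           (crosses-gap t≤a above⇒≥a) (edges H) ⟩
    sum (riseₑ t) (edges H) ∎
    where
    open ℚ.≤-Reasoning
    open +-*-Solver
    t≤a : t ℚ.≤ a
    t≤a = ℚ.<⇒≤ t<a
    above⇒≥a : ∀ x → t ℚ.< f x → a ℚ.≤ f x
    above⇒≥a x t<fx with values x t<fx
    ... | here fx≡a   = ℚ.≤-reflexive (sym fx≡a)
    ... | there fx∈ts = All.lookup a≤ts fx∈ts
    values′ : ∀ x → a ℚ.< f x → f x ∈ ts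
    values′ x a<fx with values x (ℚ.<-trans t<a a<fx)
    ... | here fx≡a   = contradiction a<fx (ℚ.<-irrefl (sym fx≡a))
    ... | there fx∈ts = fx∈ts

  -- If the values of f at the ends of each edge e differ by at most ω e, then
  -- k times the excess of f u over f v is at most the total of ω.
  capacity-bound : (ω : Edge H → ℚ) →
    (∀ e → f (Edge.end₁ e) ℚ.≤ ω e ℚ.+ f (Edge.end₂ e)
         × f (Edge.end₂ e) ℚ.≤ ω e ℚ.+ f (Edge.end₁ e)) →
    (f u ℚ.- f v) ℚ.* toℚ k ℚ.≤ sum ω (edges H)
  capacity-bound ω lipschitz = ℚ.≤-trans
    (coarea (Linked⇒AllPairs ℚ.≤-trans (sort-↗ values)) (f v)
      (λ x _ → ∈-resp-↭ (↭-sym (sort-↭ values)) (∈-map⁺ f (∈-allFin x)))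
      ℚ.≤-refl)
    (sum-mono {g = riseₑ (f v)} {h = ω} (λ e → rise≤ (proj₁ (lipschitz e)) (proj₂ (lipschitz e))) (edges H))
    where values = map f (allFin n)

-- Eccentricities

module _ {n} {H : Graph n} (c : Connected H) {k} (isEC : IsEdgeConnectivity H k)
         (w : WeightFunction H) where

  private instance
    k≢0 : ℕ.NonZero k
    k≢0 = edgeConnectivity-nonZero c isEC

  totalWeight : ℝ
  totalWeight = ∑ (map (weight w) (edges H))

  -- The distance from v to itself is at most 0, so the co-area
  -- inequality bounds its value at u and not only the difference.
  distance-bound : (∀ e → 0ℝ ≤ᵗ weight w e) → ∀ u v →
    distance w c u v ≤ᵗ fromℚ (pos 1 / k) * totalWeight
  distance-bound w≥0 u v i = begin
    d u
      ≡⟨ trans (sym (ℚ.*-identityˡ (d u))) (cong (ℚ._* d u) (sym (1/n*n≡1 k))) ⟩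
    (r ℚ.* toℚ k) ℚ.* d u
      ≡⟨ solve 3 (λ r k u → (r :* k) :* u := r :* ((u :- con 0ℚ) :* k)) refl r (toℚ k) (d u) ⟩
    r ℚ.* ((d u ℚ.- 0ℚ) ℚ.* toℚ k)
      ≤⟨ times-r (ℚ.*-monoʳ-≤-nonNeg (toℚ k) {{ℚ.nonNegative (0≤fraction k 1)}}
           (ℚ.+-monoʳ-≤ (d u) (ℚ.neg-antimono-≤ (distance-self≤0 w i c v)))) ⟩
    r ℚ.* ((d u ℚ.- d v) ℚ.* toℚ k)
      ≤⟨ times-r (capacity-bound H (IsEdgeConnectivity.minimal isEC) d u v (weightᵢ w i)
           (distance-lipschitz w i (λ e → w≥0 e i) c v)) ⟩
    r ℚ.* sum (weightᵢ w i) (edges H)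
      ≡⟨ cong (r ℚ.*_) (sym (seq-∑ (weight w) i (edges H))) ⟩
    r ℚ.* seq totalWeight i ∎
    where
    open ℚ.≤-Reasoning
    open +-*-Solver
    r : ℚ
    r = pos 1 / k
    d : Fin n → ℚ
    d x = distanceᵢ w i c x v
    times-r : ∀ {p q} → p ℚ.≤ q → r ℚ.* p ℚ.≤ r ℚ.* q
    times-r = ℚ.*-monoˡ-≤-nonNeg r {{ℚ.nonNegative (0≤fraction 1 k)}}

  distance-nonneg : ∀ u v → 0ℝ ≤ distance w c u v
  distance-nonneg u v = foldr-map-pred (0ℝ ≤_) (λ x y → ⊓-glb x y 0ℝ)
    (path-nonneg (Connected.path c u v)) path-nonneg (paths H u v)
    where
    linked-nonneg : ∀ {xs} (l : Linked (Adj H) xs) → 0ℝ ≤ linkedWeight w l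
    linked-nonneg []       = ≤ᵗ⇒≤ 0ℝ 0ℝ λ _ → ℚ.≤-refl
    linked-nonneg [-]      = ≤ᵗ⇒≤ 0ℝ 0ℝ λ _ → ℚ.≤-refl
    linked-nonneg (uv ∷ l) = +-nonneg (weight w (edge H uv)) (linkedWeight w l)
      (weight≥0 w (edge H uv)) (linked-nonneg l)
    path-nonneg : (p : Path H u v) → 0ℝ ≤ pathWeight w p
    path-nonneg p = linked-nonneg (Path.linked p)

  eccentricity-nonneg : ∀ v → 0ℝ ≤ eccentricity w c v
  eccentricity-nonneg v = foldr-map-pred (0ℝ ≤_) 0≤⊔
    (distance-nonneg v v) (λ u → distance-nonneg u v) (allFin n)
    where
    0≤⊔ : ∀ x y → 0ℝ ≤ x → 0ℝ ≤ y → 0ℝ ≤ x ⊔ y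
    0≤⊔ x y 0≤x _ = ≤-trans 0ℝ x (x ⊔ y) 0≤x
      (≤ᵗ⇒≤ x (x ⊔ y) λ i → ℚ.p≤p⊔q (seq x i) (seq y i))

module _ {n} {H : Graph n} (c : Connected H) (w w′ : WeightFunction H)
         (w≤w′ : ∀ e → weight w e ≤ᵗ weight w′ e) where

  distance-mono : ∀ u v → distance w c u v ≤ᵗ distance w′ c u v
  distance-mono u v = foldr-map-mono _≤ᵗ_
    (λ a b c d a≤b c≤d i → ℚ.⊓-mono-≤ (a≤b i) (c≤d i))
    (λ i → path-mono i (Connected.path c u v)) (λ p i → path-mono i p) (paths H u v)
    where
    linked-mono : ∀ i {xs} (l : Linked (Adj H) xs) →
      seq (linkedWeight w l) i ℚ.≤ seq (linkedWeight w′ l) i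
    linked-mono i []       = ℚ.≤-refl
    linked-mono i [-]      = ℚ.≤-refl
    linked-mono i (uv ∷ l) = ℚ.+-mono-≤ (w≤w′ (edge H uv) i) (linked-mono i l)
    path-mono : ∀ i (p : Path H u v) → pathWeightᵢ w i p ℚ.≤ pathWeightᵢ w′ i p
    path-mono i p = linked-mono i (Path.linked p)

module _ {n} {H : Graph n} (c : Connected H) {k} (isEC : IsEdgeConnectivity H k)
         (w : WeightFunction H) where

  private instance
    k≢0 : ℕ.NonZero k
    k≢0 = edgeConnectivity-nonZero c isEC
    n≢0 : ℕ.NonZero n
    n≢0 = Connected.nonEmpty c

  -- The same weights, represented by sequences of nonnegative rationals.
  positivePart : WeightFunction H
  positivePart = record
    { weight   = λ e → 0ℝ ⊔ weight w e
    ; weight≥0 = λ e → ≤ᵗ⇒≤ 0ℝ (0ℝ ⊔ weight w e) λ i →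
        ℚ.p≤p⊔q 0ℚ (seq (weight w e) i)
    }

  eccentricity-bound : IsNormalised w → ∀ v →
    eccentricity w c v ≤ fromℚ (pos (numEdges H) / k)
  eccentricity-bound normalised v =
    ≤-trans (eccentricity w c v) (fromℚ r * totalWeight c isEC positivePart) (fromℚ (pos m / k))
      (≤ᵗ⇒≤ (eccentricity w c v) (fromℚ r * totalWeight c isEC positivePart)
        (foldr-map-pred (_≤ᵗ bound) (λ a b a≤ b≤ i → ℚ.⊔-lub (a≤ i) (b≤ i))
          (distance≤ v) distance≤ (allFin n)))
      (≤-trans (fromℚ r * totalWeight c isEC positivePart) (fromℚ r * fromℕ m) (fromℚ (pos m / k))
        (*-monoʳ-≤ (totalWeight c isEC positivePart) (fromℕ m) (fromℚ r)
          (0≤fromℚ (0≤fraction 1 k))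
          (≤-trans (totalWeight c isEC positivePart) (totalWeight c isEC w) (fromℕ m)
            total≤ (proj₁ normalised)))
        (≤ᵗ⇒≤ (fromℚ r * fromℕ m) (fromℚ (pos m / k)) λ _ →
          ℚ.≤-reflexive (1/k*m≡m/k m k)))
    where
    m : ℕ
    m = numEdges H
    r : ℚ
    r = pos 1 / k
    bound : ℝ
    bound = fromℚ r * totalWeight c isEC positivePart
    distance≤ : ∀ u → distance w c u v ≤ᵗ bound
    distance≤ u i = ℚ.≤-trans
      (distance-mono c w positivePart
        (λ e i → ℚ.p≤q⊔p 0ℚ (seq (weight w e) i)) u v i)
      (distance-bound c isEC positivePart
        (λ e i → ℚ.p≤p⊔q 0ℚ (seq (weight w e) i)) u v i)
    total≤ : totalWeight c isEC positivePart ≤ totalWeight c isEC w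
    total≤ = foldr-map-mono _≤_ +-mono-≤ (≤ᵗ⇒≤ 0ℝ 0ℝ λ _ → ℚ.≤-refl)
      (λ e → ⊔-lub 0ℝ (weight w e) (weight w e) (weight≥0 w e)
        (≤ᵗ⇒≤ (weight w e) (weight w e) λ _ → ℚ.≤-refl))
      (edges H)

  avec-nonneg : 0ℝ ≤ avec w c
  avec-nonneg = *-nonneg (fromℚ (pos 1 / n)) (∑ (map (eccentricity w c) (allFin n)))
    (0≤fromℚ (0≤fraction 1 n))
    (foldr-map-pred (0ℝ ≤_) +-nonneg (≤ᵗ⇒≤ 0ℝ 0ℝ λ _ → ℚ.≤-refl)
      (eccentricity-nonneg c isEC w) (allFin n))

  avec-bound : IsNormalised w → avec w c ≤ fromℚ (pos (numEdges H) / k)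
  avec-bound normalised = ≤-trans (avec w c) (fromℚ r * fromℚ (ℓ ℚ.* q)) (fromℚ q)
    (*-monoʳ-≤ (∑ (map (eccentricity w c) (allFin n))) (fromℚ (ℓ ℚ.* q)) (fromℚ r)
      (0≤fromℚ (0≤fraction 1 n))
      (∑-≤-fromℚ (eccentricity w c) q (eccentricity-bound normalised) (allFin n)))
    (≤ᵗ⇒≤ (fromℚ r * fromℚ (ℓ ℚ.* q)) (fromℚ q) λ _ → ℚ.≤-reflexive
      (trans (sym (ℚ.*-assoc r ℓ q)) (trans (cong (ℚ._* q) rℓ≡1) (ℚ.*-identityˡ q))))
    where
    q r ℓ : ℚ
    q = pos (numEdges H) / k
    r = pos 1 / n
    ℓ = toℚ (length (allFin n))
    rℓ≡1 : r ℚ.* ℓ ≡ 1ℚ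
    rℓ≡1 = trans (cong (λ j → r ℚ.* toℚ j) (length-tabulate {n = n} (λ x → x))) (1/n*n≡1 n)

corollary3p6 :
    ∀ {n : ℕ} (G : Graph n)
      (c : Connected G) (c̄ : Connected (∁ G)) →
      ¬ IsTree G → ¬ IsTree (∁ G) →
      (k k̄ : ℕ)
      (isEC : IsEdgeConnectivity G k) (isEC̄ : IsEdgeConnectivity (∁ G) k̄)
      (w : WeightFunction G) (w̄ : WeightFunction (∁ G)) →
      IsNormalised w → IsNormalised w̄ →
      let m  = numEdges G
          m̄  = numEdges (∁ G)
          instance
            k≢0 = edgeConnectivity-nonZero c isEC
            k̄≢0 = edgeConnectivity-nonZero c̄ isEC̄
            kk̄≢0 = m*n≢0 k k̄
      in
      (0ℝ ≤ avec w c + avec w̄ c̄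
        × avec w c + avec w̄ c̄ ≤ fromℚ (pos m / k) + fromℚ (pos m̄ / k̄))
      × (0ℝ ≤ avec w c * avec w̄ c̄
        × avec w c * avec w̄ c̄ ≤ fromℚ (pos (m *ℕ m̄) / (k *ℕ k̄)))
corollary3p6 {n} G c c̄ _ _ k k̄ isEC isEC̄ w w̄ normalised normalised̄ =
  ( +-nonneg a ā 0≤a 0≤ā
  , +-mono-≤ a (fromℚ q) ā (fromℚ q̄) a≤q ā≤q̄ )
  , ( *-nonneg a ā 0≤a 0≤ā
    , subst (λ r → a * ā ≤ fromℚ r) (fraction-* m k m̄ k̄)
        (*-≤-fromℚ a ā (0≤fraction m k) 0≤ā a≤q ā≤q̄) )
  where
  instance
    k≢0 : ℕ.NonZero k
    k≢0 = edgeConnectivity-nonZero c isEC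
    k̄≢0 : ℕ.NonZero k̄
    k̄≢0 = edgeConnectivity-nonZero c̄ isEC̄
  m m̄ : ℕ
  m = numEdges G
  m̄ = numEdges (∁ G)
  q q̄ : ℚ
  q = pos m / k
  q̄ = pos m̄ / k̄
  a ā : ℝ
  a = avec w c
  ā = avec w̄ c̄
  0≤a : 0ℝ ≤ a
  0≤a = avec-nonneg c isEC w
  0≤ā : 0ℝ ≤ ā
  0≤ā = avec-nonneg c̄ isEC̄ w̄
  a≤q : a ≤ fromℚ q
  a≤q = avec-bound c isEC w normalised
  ā≤q̄ : ā ≤ fromℚ q̄
  ā≤q̄ = avec-bound c̄ isEC̄ w̄ normalised̄
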